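{- Let $P$ be a pinwheel tiling. The minimal number of colours in a proper face colouring of $P$ is $3$.
   Context: Pinwheel substitution. The prototile $K$ is the right triangle with side lengths $1,2,\sqrt5$. The substitution $\omega$ expands a tile by $\sqrt5$ and dissects it into five tiles: the expanded tile, placed as the triangle with vertices $(0,0)$ (right angle), $(2,-1)$, $(2,4)$, is dissected into the triangles with vertices $\{(2,-1),(2,0),(0,0)\}$, $\{(0,0),(1,0),(1,2)\}$, $\{(1,0),(2,0),(1,2)\}$, $\{(2,0),(2,2),(1,2)\}$, $\{(1,2),(2,2),(2,4)\}$. The rule is extended to all congruent copies of $K$ (including reflections) and to collections of tiles covariantly. A pinwheel tiling is a tiling $P$ of $\mathbb{R}^2$ by congruent copies of $K$ such that every finite set of tiles of $P$ is contained in a congruent copy of $\omega^n(K)$ for some $n\ge0$. A proper face colouring is an assignment of colours to the tiles such that any two distinct tiles whose boundaries share a segment of positive length have different colours. -}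

module Defs where

open import Level using (0ℓ; suc)
open import Algebra.Bundles using (CommutativeRing)
import Algebra.Definitions.RawMonoid as RawMonoidDefs
open import Data.Fin.Base using (Fin)
open import Data.List.Base using (List; []; _∷_)
open import Data.List.Relation.Unary.All using (All)
open import Data.List.Relation.Unary.Any using (Any)
open import Data.Nat.Base as ℕ using (ℕ)
open import Data.Product.Base using (Σ; ∃; ∃-syntax; _×_; proj₁)
open import Data.Sum.Base using (_⊎_)
open import Relation.Binary.Core using (Rel)
open import Relation.Binary.Definitions using (_Respects_)
open import Relation.Binary.PropositionalEquality.Core using (_≡_; _≢_)
open import Relation.Binary.Structures using (IsTotalOrder)
open import Relation.Nullary.Negation.Core using (¬_)
open import Relation.Unary using (Pred; _∈_; Satisfiable)

-- The real numbers, axiomatised as a Dedekind-complete ordered field.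
-- Equality is a setoid equality, as everywhere in `Algebra`.
record CompleteOrderedField : Set (suc 0ℓ) where
  field
    commutativeRing : CommutativeRing 0ℓ 0ℓ
  open CommutativeRing commutativeRing public
  infix 4 _≤_ _<_
  field
    _≤_           : Rel Carrier 0ℓ
    isTotalOrder  : IsTotalOrder _≈_ _≤_
    +-monoˡ-≤     : ∀ z {x y} → x ≤ y → x + z ≤ y + z
    *-nonNegative : ∀ {x y} → 0# ≤ x → 0# ≤ y → 0# ≤ x * y
    0≉1           : ¬ 0# ≈ 1#
    inverse       : ∀ x → ¬ x ≈ 0# → ∃[ y ] x * y ≈ 1#

  UpperBound : Pred Carrier 0ℓ → Pred Carrier 0ℓ
  UpperBound S b = ∀ x → x ∈ S → x ≤ b

  field
    supremum : ∀ (S : Pred Carrier 0ℓ) → Satisfiable S → Satisfiable (UpperBound S) →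
               ∃[ s ] s ∈ UpperBound S × (∀ b → b ∈ UpperBound S → s ≤ b)

  _<_ : Rel Carrier 0ℓ
  x < y = x ≤ y × ¬ x ≈ y

  private module M = RawMonoidDefs +-rawMonoid

  fromℕ : ℕ → Carrier
  fromℕ n = n M.× 1#

IsMinimum : Pred ℕ 0ℓ → Pred ℕ 0ℓ
IsMinimum Q n = Q n × (∀ k → Q k → n ℕ.≤ k)

module Pinwheel (ℝ : CompleteOrderedField) where
  open CompleteOrderedField ℝ

  record Point : Set where
    constructor ⟨_,_⟩
    field
      x-coord y-coord : Carrier
  open Point public

  infix  4 _≈ₚ_
  infixl 6 _+ₚ_
  infixr 7 _*ₚ_

  _≈ₚ_ : Rel Point 0ℓ
  p ≈ₚ q = x-coord p ≈ x-coord q × y-coord p ≈ y-coord q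

  _+ₚ_ : Point → Point → Point
  p +ₚ q = ⟨ x-coord p + x-coord q , y-coord p + y-coord q ⟩

  _*ₚ_ : Carrier → Point → Point
  k *ₚ p = ⟨ k * x-coord p , k * y-coord p ⟩

  dot : Point → Point → Carrier
  dot p q = x-coord p * x-coord q + y-coord p * y-coord q

  -- Congruences of the plane, reflections included: p ↦ A p + translation,
  -- where A is the orthogonal matrix with columns column₁ and column₂.
  record Congruence : Set where
    field
      column₁ column₂ translation : Point
      unit₁      : dot column₁ column₁ ≈ 1#
      unit₂      : dot column₂ column₂ ≈ 1#
      orthogonal : dot column₁ column₂ ≈ 0#

  move : Congruence → Point → Point
  move g p = x-coord p *ₚ column₁ +ₚ y-coord p *ₚ column₂ +ₚ translation
    where open Congruence g

  -- Vertices are listed in the order: right angle, other end of the short leg,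
  -- other end of the long leg.  A copy of the prototile has three different
  -- side lengths, so it determines this list, and two copies are the same
  -- subset of the plane exactly when they are related by _≈ₜ_.
  record Triangle : Set where
    constructor triangle
    field
      right short long : Point
  open Triangle public

  infix 4 _≈ₜ_

  _≈ₜ_ : Rel Triangle 0ℓ
  t ≈ₜ u = right t ≈ₚ right u × short t ≈ₚ short u × long t ≈ₚ long u

  mapVertices : (Point → Point) → Triangle → Triangle
  mapVertices f t = triangle (f (right t)) (f (short t)) (f (long t))

  infixr 7 _·_

  _·_ : Congruence → Triangle → Triangle
  g · t = mapVertices (move g) t

  dilate : Carrier → Triangle → Triangle
  dilate r = mapVertices (r *ₚ_)

  Segment : Point → Point → Pred Point 0ℓ
  Segment p q z = ∃[ a ] ∃[ b ]
    0# ≤ a × 0# ≤ b × a + b ≈ 1# × z ≈ₚ a *ₚ p +ₚ b *ₚ q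

  Closed : Triangle → Pred Point 0ℓ
  Closed t z = ∃[ a ] ∃[ b ] ∃[ c ]
    0# ≤ a × 0# ≤ b × 0# ≤ c × a + b + c ≈ 1# ×
    z ≈ₚ a *ₚ right t +ₚ b *ₚ short t +ₚ c *ₚ long t

  Interior : Triangle → Pred Point 0ℓ
  Interior t z = ∃[ a ] ∃[ b ] ∃[ c ]
    0# < a × 0# < b × 0# < c × a + b + c ≈ 1# ×
    z ≈ₚ a *ₚ right t +ₚ b *ₚ short t +ₚ c *ₚ long t

  Boundary : Triangle → Pred Point 0ℓ
  Boundary t z = z ∈ Segment (right t) (short t)
               ⊎ z ∈ Segment (right t) (long t)
               ⊎ z ∈ Segment (short t) (long t)

  point : ℕ → ℕ → Point
  point m n = ⟨ fromℕ m , fromℕ n ⟩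

  K : Triangle
  K = triangle (point 0 0) (point 1 0) (point 0 2)

  Δ : Triangle
  Δ = triangle (point 0 0) ⟨ fromℕ 2 , - 1# ⟩ (point 2 4)

  dissection : List Triangle
  dissection = triangle (point 2 0) ⟨ fromℕ 2 , - 1# ⟩ (point 0 0)
             ∷ triangle (point 1 0) (point 0 0) (point 1 2)
             ∷ triangle (point 1 0) (point 2 0) (point 1 2)
             ∷ triangle (point 2 2) (point 1 2) (point 2 0)
             ∷ triangle (point 2 2) (point 1 2) (point 2 4)
             ∷ []

  -- substitute t is ω(t) as a set of tiles: r is √5, and g is the congruence
  -- taking Δ onto √5 t, along which the dissection of Δ is transported.
  substitute : Triangle → Pred Triangle 0ℓ
  substitute t s = ∃[ r ] ∃[ g ]
    0# ≤ r × r * r ≈ fromℕ 5 × g · Δ ≈ₜ dilate r t ×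
    Any (λ d → s ≈ₜ g · d) dissection

  ω : Pred Triangle 0ℓ → Pred Triangle 0ℓ
  ω S s = ∃[ t ] t ∈ S × s ∈ substitute t

  ωⁿK : ℕ → Pred Triangle 0ℓ
  ωⁿK ℕ.zero    = _≈ₜ K
  ωⁿK (ℕ.suc n) = ω (ωⁿK n)

  image : Congruence → Pred Triangle 0ℓ → Pred Triangle 0ℓ
  image g S s = ∃[ t ] t ∈ S × s ≈ₜ g · t

  record IsTiling (P : Pred Triangle 0ℓ) : Set where
    field
      respects : P Respects _≈ₜ_
      copies   : ∀ {t} → t ∈ P → ∃[ g ] t ≈ₜ g · K
      covers   : ∀ z → ∃[ t ] t ∈ P × z ∈ Closed t
      packs    : ∀ {t u} → t ∈ P → u ∈ P →
                 ∀ z → z ∈ Interior t → z ∈ Interior u → t ≈ₜ u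

  record IsPinwheelTiling (P : Pred Triangle 0ℓ) : Set where
    field
      isTiling : IsTiling P
      patches  : ∀ (F : List Triangle) → All P F →
                 ∃[ n ] ∃[ g ] All (image g (ωⁿK n)) F

  ShareSegment : Rel Triangle 0ℓ
  ShareSegment t u = ∃[ p ] ∃[ q ]
    ¬ p ≈ₚ q × (∀ z → z ∈ Segment p q → z ∈ Boundary t × z ∈ Boundary u)

  record ProperFaceColouring (P : Pred Triangle 0ℓ) (k : ℕ) : Set where
    field
      colour      : Σ Triangle P → Fin k
      colour-cong : ∀ t u → proj₁ t ≈ₜ proj₁ u → colour t ≡ colour u
      proper      : ∀ t u → ¬ proj₁ t ≈ₜ proj₁ u →
                    ShareSegment (proj₁ t) (proj₁ u) → colour t ≢ colour u

module Submission where

-- Everything is affine in the vertices of a tile: the five pieces of a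
-- supertile have rational barycentric coordinates with respect to it, and so
-- have its neighbours.  Descending through the substitution, one finds that two
-- tiles of ωⁿ(K) with more than one common point are in one of twelve relative
-- positions (one of them equality), the other pairs of pieces being separated
-- by a linear functional.  A tile carries a state, namely one of three types and
-- a colour in ℤ/3; the state of a piece depends only on the state of the tile
-- and the index of the piece, and the rules are such that the finite set of
-- triples (relative position, types, colour difference) that occur is closed
-- under subdivision and has nonzero differences between distinct tiles.  This
-- colours every ωⁿ(K), hence every finite part of P.  By the patch condition
-- each tile of P is linked to a fixed one by a word in the piece indices, so P
-- is countable and König's lemma gives a colouring of P.
--
-- Conversely, the three pieces at the midpoint of the long leg of the first one
-- are pairwise adjacent.  To find such a triple in P, take a tile t and
-- probe the centres of all tiles that would be siblings of t for each of the
-- five positions that t may have in a supertile; a patch containing the probed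
-- tiles contains a supertile around t, whose pieces must be probed tiles.

open import Defs
open import Level using (0ℓ)
open import Algebra.Solver.Ring.AlmostCommutativeRing
  using (_-Raw-AlmostCommutative⟶_; fromCommutativeRing)
import Algebra.Solver.Ring as RingSolver
import Algebra.Properties.Ring as RingProperties
import Algebra.Properties.Semiring.Mult as Mult
open import Axiom.DoubleNegationElimination using (em⇒dne)
open import Axiom.ExcludedMiddle using (ExcludedMiddle)
open import Data.Bool.Base using (if_then_else_)
open import Data.Fin.Base using (Fin; zero; suc; toℕ; fromℕ<; combine; remQuot)
import Data.Fin.Literals as FinLiterals
open import Data.Fin.Patterns using (0F; 1F; 2F; 3F; 4F)
import Data.Fin.Properties as Fin
open import Data.Integer.Base as ℤ using (ℤ; +_; -[1+_]; _⊖_)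
import Data.Integer.Literals as ℤLiterals
import Data.Integer.Properties as ℤ
import Data.Integer.Solver as ℤSolver
open import Data.List.Base as List
  using (List; []; _∷_; map; applyUpTo; allFin; cartesianProductWith)
import Data.List.Membership.DecPropositional as DecMembership
open import Data.List.Membership.Propositional renaming (_∈_ to _∈ₗ_) using ()
open import Data.List.Membership.Propositional.Properties
  using (∈-map⁺; ∈-cartesianProductWith⁺; ∈-allFin)
open import Data.List.Relation.Unary.All as All using (All)
import Data.List.Relation.Unary.All.Properties as All
open import Data.List.Relation.Unary.Any as Any using (Any; here; there)
open import Data.List.Relation.Unary.Any.Properties using (lookup-index)
open import Data.Maybe.Base using (Maybe; just; nothing)
open import Data.Nat.Base as ℕ using (ℕ; zero; suc; _⊔_)
open import Data.Nat.Binary.Base as ℕᵇ using (ℕᵇ; zero; 2[1+_]; 1+[2_])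
import Data.Nat.Binary.Properties as ℕᵇ
import Data.Nat.Literals as ℕLiterals
import Data.Nat.Properties as ℕ
open import Data.Product.Base using (Σ; ∃; ∃-syntax; _×_; _,_; proj₁; proj₂)
open import Data.Product.Properties using (≡-dec)
open import Data.Sum.Base using (_⊎_; inj₁; inj₂; [_,_]′)
open import Data.Unit.Base using (tt)
open import Data.Vec.Base as Vec using (Vec; []; _∷_; lookup)
import Relation.Binary.PropositionalEquality as ≡
open ≡ using (_≡_; _≢_)
import Relation.Binary.Reasoning.Setoid as SetoidReasoning
open import Relation.Binary.Structures using (IsTotalOrder)
open import Relation.Nullary using (¬_; Dec; yes; no; does; contradiction)
open import Relation.Nullary.Decidable using (from-yes; _×-dec_; _⊎-dec_; _→-dec_; ¬?)
open import Relation.Unary using (Pred; Satisfiable; _∈_)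

-- Integer matrices and the tables of the substitution

Matrix : Set
Matrix = Fin 3 → Fin 3 → ℤ

infixl 7 _⊗_
_⊗_ : Matrix → Matrix → Matrix
(A ⊗ B) k l = A k 0F ℤ.* B 0F l ℤ.+ A k 1F ℤ.* B 1F l ℤ.+ A k 2F ℤ.* B 2F l

infixl 7 _⊙_
_⊙_ : Matrix → Vec ℤ 3 → Fin 3 → ℤ
(A ⊙ (x ∷ y ∷ z ∷ [])) k = A k 0F ℤ.* x ℤ.+ A k 1F ℤ.* y ℤ.+ A k 2F ℤ.* z

module Tables where
  open import Agda.Builtin.FromNat using (Number; fromNat)
  open import Agda.Builtin.FromNeg using (Negative; fromNeg)

  instance
    ℕ-number : Number _
    ℕ-number = ℕLiterals.number
    ℤ-number : Number ℤ
    ℤ-number = ℤLiterals.number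
    ℤ-negative : Negative ℤ
    ℤ-negative = ℤLiterals.negative
    Fin-number : ∀ {n} → Number (Fin n)
    Fin-number {n} = FinLiterals.number n

  rows : Vec (Vec ℤ 3) 3 → Matrix
  rows m k l = lookup (lookup m k) l

  Family : ℕ → Set
  Family n = Vec (Vec (Vec ℤ 3) 3) n

  -- Rows are vertices in the order right, short, long; columns are barycentric
  -- coordinates, times 10, with respect to the vertices of Δ.
  pieces : Family 5
  pieces =
      ((0 ∷ 8 ∷ 2 ∷ []) ∷ (0 ∷ 10 ∷ 0 ∷ []) ∷ (10 ∷ 0 ∷ 0 ∷ []) ∷ [])
    ∷ ((5 ∷ 4 ∷ 1 ∷ []) ∷ (10 ∷ 0 ∷ 0 ∷ []) ∷ (5 ∷ 0 ∷ 5 ∷ []) ∷ [])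
    ∷ ((5 ∷ 4 ∷ 1 ∷ []) ∷ (0 ∷ 8 ∷ 2 ∷ []) ∷ (5 ∷ 0 ∷ 5 ∷ []) ∷ [])
    ∷ ((0 ∷ 4 ∷ 6 ∷ []) ∷ (5 ∷ 0 ∷ 5 ∷ []) ∷ (0 ∷ 8 ∷ 2 ∷ []) ∷ [])
    ∷ ((0 ∷ 4 ∷ 6 ∷ []) ∷ (5 ∷ 0 ∷ 5 ∷ []) ∷ (0 ∷ 0 ∷ 10 ∷ []) ∷ [])
    ∷ []

  -- 20 times the inverses of `pieces`.
  unpieces : Family 5
  unpieces =
      ((0 ∷ 0 ∷ 2 ∷ []) ∷ (0 ∷ 2 ∷ 0 ∷ []) ∷ (10 ∷ -8 ∷ 0 ∷ []) ∷ [])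
    ∷ ((0 ∷ 2 ∷ 0 ∷ []) ∷ (5 ∷ -2 ∷ -1 ∷ []) ∷ (0 ∷ -2 ∷ 4 ∷ []) ∷ [])
    ∷ ((4 ∷ -2 ∷ 0 ∷ []) ∷ (1 ∷ 2 ∷ -1 ∷ []) ∷ (-4 ∷ 2 ∷ 4 ∷ []) ∷ [])
    ∷ ((-4 ∷ 4 ∷ 2 ∷ []) ∷ (-1 ∷ 0 ∷ 3 ∷ []) ∷ (4 ∷ 0 ∷ -2 ∷ []) ∷ [])
    ∷ ((0 ∷ 4 ∷ -2 ∷ []) ∷ (5 ∷ 0 ∷ -3 ∷ []) ∷ (0 ∷ 0 ∷ 2 ∷ []) ∷ [])
    ∷ []

  -- The relative positions of two tiles of ωⁿ(K) with more than one common point,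
  -- scaled like `pieces`.  The first one is equality, and the ninth one is the
  -- reflection in the hypotenuse, the only one whose coordinates need fifths.
  neighbours : Family 12
  neighbours =
      ((10 ∷ 0 ∷ 0 ∷ []) ∷ (0 ∷ 10 ∷ 0 ∷ []) ∷ (0 ∷ 0 ∷ 10 ∷ []) ∷ [])
    ∷ ((5 ∷ 0 ∷ 5 ∷ []) ∷ (0 ∷ 0 ∷ 10 ∷ []) ∷ (25 ∷ -20 ∷ 5 ∷ []) ∷ [])
    ∷ ((5 ∷ 0 ∷ 5 ∷ []) ∷ (10 ∷ 0 ∷ 0 ∷ []) ∷ (25 ∷ -20 ∷ 5 ∷ []) ∷ [])
    ∷ ((20 ∷ -10 ∷ 0 ∷ []) ∷ (25 ∷ -10 ∷ -5 ∷ []) ∷ (0 ∷ 10 ∷ 0 ∷ []) ∷ [])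
    ∷ ((10 ∷ 0 ∷ 0 ∷ []) ∷ (20 ∷ -10 ∷ 0 ∷ []) ∷ (0 ∷ 0 ∷ 10 ∷ []) ∷ [])
    ∷ ((0 ∷ 10 ∷ 0 ∷ []) ∷ (5 ∷ 10 ∷ -5 ∷ []) ∷ (20 ∷ -10 ∷ 0 ∷ []) ∷ [])
    ∷ ((-10 ∷ 10 ∷ 10 ∷ []) ∷ (0 ∷ 0 ∷ 10 ∷ []) ∷ (0 ∷ 10 ∷ 0 ∷ []) ∷ [])
    ∷ ((10 ∷ 0 ∷ 0 ∷ []) ∷ (0 ∷ 10 ∷ 0 ∷ []) ∷ (20 ∷ 0 ∷ -10 ∷ []) ∷ [])
    ∷ ((-10 ∷ 16 ∷ 4 ∷ []) ∷ (0 ∷ 10 ∷ 0 ∷ []) ∷ (0 ∷ 0 ∷ 10 ∷ []) ∷ [])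
    ∷ ((5 ∷ 0 ∷ 5 ∷ []) ∷ (15 ∷ -10 ∷ 5 ∷ []) ∷ (15 ∷ 0 ∷ -5 ∷ []) ∷ [])
    ∷ ((5 ∷ 0 ∷ 5 ∷ []) ∷ (15 ∷ -10 ∷ 5 ∷ []) ∷ (-5 ∷ 0 ∷ 15 ∷ []) ∷ [])
    ∷ ((15 ∷ 0 ∷ -5 ∷ []) ∷ (25 ∷ -10 ∷ -5 ∷ []) ∷ (5 ∷ 0 ∷ 5 ∷ []) ∷ [])
    ∷ []

  -- Linear functionals, by their values at the vertices of a tile, that suffice
  -- to separate the pieces that do not touch.
  directions : List (Vec ℤ 3)
  directions =
      (0 ∷ -1 ∷ 0 ∷ []) ∷ (0 ∷ 0 ∷ -1 ∷ []) ∷ (0 ∷ 3 ∷ 8 ∷ []) ∷ (0 ∷ 1 ∷ 1 ∷ [])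
    ∷ (0 ∷ -1 ∷ 4 ∷ []) ∷ (0 ∷ 1 ∷ -4 ∷ []) ∷ (0 ∷ -3 ∷ -8 ∷ []) ∷ (0 ∷ -1 ∷ -1 ∷ [])
    ∷ (0 ∷ 1 ∷ -2 ∷ []) ∷ []

  -- The entry (y , d) for piece i and type x: that piece of a tile of type x and
  -- colour c has type y and colour c ⊕ d.  The rules were found by computer search.
  rules : Vec (Vec (Fin 3 × Fin 3) 3) 5
  rules =
      ((0 , 1) ∷ (1 , 1) ∷ (1 , 2) ∷ [])
    ∷ ((0 , 0) ∷ (1 , 2) ∷ (1 , 0) ∷ [])
    ∷ ((0 , 2) ∷ (2 , 0) ∷ (2 , 1) ∷ [])
    ∷ ((2 , 0) ∷ (0 , 2) ∷ (0 , 0) ∷ [])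
    ∷ ((1 , 2) ∷ (0 , 0) ∷ (0 , 1) ∷ [])
    ∷ []

  -- The entry (x , x′ , d) for position e: a tile of type x and colour c may have
  -- in position e a tile of type x′ and colour c ⊕ d.
  contactTable : Vec (List (Fin 3 × Fin 3 × Fin 3)) 12
  contactTable =
      ((0 , 0 , 0) ∷ (1 , 1 , 0) ∷ (2 , 2 , 0) ∷ [])
    ∷ ((0 , 0 , 2) ∷ (1 , 1 , 1) ∷ [])
    ∷ ((0 , 0 , 1) ∷ (1 , 2 , 2) ∷ [])
    ∷ ((0 , 0 , 1) ∷ (1 , 1 , 2) ∷ [])
    ∷ ((0 , 0 , 1) ∷ (0 , 0 , 2) ∷ (1 , 1 , 1) ∷ (1 , 1 , 2) ∷ (1 , 2 , 1)
       ∷ (2 , 1 , 2) ∷ (2 , 2 , 1) ∷ (2 , 2 , 2) ∷ [])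
    ∷ ((0 , 0 , 2) ∷ (2 , 1 , 1) ∷ [])
    ∷ ((0 , 1 , 2) ∷ (0 , 2 , 1) ∷ (1 , 0 , 1) ∷ (2 , 0 , 2) ∷ [])
    ∷ ((0 , 0 , 1) ∷ (0 , 0 , 2) ∷ (1 , 1 , 1) ∷ (1 , 1 , 2) ∷ (1 , 2 , 1) ∷ (2 , 1 , 2) ∷ [])
    ∷ ((0 , 0 , 1) ∷ (0 , 0 , 2) ∷ (1 , 1 , 1) ∷ (1 , 1 , 2) ∷ [])
    ∷ ((0 , 2 , 2) ∷ (2 , 0 , 1) ∷ [])
    ∷ ((0 , 1 , 1) ∷ (2 , 0 , 2) ∷ [])
    ∷ ((0 , 2 , 1) ∷ (1 , 0 , 2) ∷ [])
    ∷ []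

open Tables using (rows; directions)

infixl 6 _⊕_

-- The tables are opaque outside abstract blocks, so the geometry below can use only the facts
-- verified by the finite checks.
abstract
  piece unpiece : Fin 5 → Matrix
  piece i   = rows (lookup Tables.pieces i)
  unpiece i = rows (lookup Tables.unpieces i)

  neighbour : Fin 12 → Matrix
  neighbour e = rows (lookup Tables.neighbours e)

  contacts : Fin 12 → List (Fin 3 × Fin 3 × Fin 3)
  contacts e = lookup Tables.contactTable e

  _⊕_ : Fin 3 → Fin 3 → Fin 3
  0F ⊕ j  = j
  1F ⊕ 0F = 1F
  1F ⊕ 1F = 2F
  1F ⊕ 2F = 0F
  2F ⊕ 0F = 2F
  2F ⊕ 1F = 0F
  2F ⊕ 2F = 1F

  childType childShift : Fin 5 → Fin 3 → Fin 3
  childType  i x = proj₁ (lookup (lookup Tables.rules i) x)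
  childShift i x = proj₂ (lookup (lookup Tables.rules i) x)

-- States, balanced matrices and separation by functionals

State : Set
State = Fin 3 × Fin 3

child : Fin 5 → State → State
child i (x , c) = childType i x , c ⊕ childShift i x

infix 4 _≡ₘ_
_≡ₘ_ : Matrix → Matrix → Set
A ≡ₘ B = ∀ k l → A k l ≡ B k l

_≡ₘ?_ : ∀ A B → Dec (A ≡ₘ B)
A ≡ₘ? B = Fin.all? λ k → Fin.all? λ l → A k l ℤ.≟ B k l

scalar : ℤ → Matrix
scalar c k l = if does (k Fin.≟ l) then c else + 0

-- Divided by c, the rows are then barycentric coordinates, and the triangle that they describe is
-- compatible with translations.
Balanced : ℤ → Matrix → Set
Balanced c M = ∀ k → M k 0F ℤ.+ M k 1F ℤ.+ M k 2F ≡ c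

balanced? : ∀ c M → Dec (Balanced c M)
balanced? c M = Fin.all? λ k → M k 0F ℤ.+ M k 1F ℤ.+ M k 2F ℤ.≟ c

-- A balanced matrix has the all-ones vector as an eigenvector with eigenvalue c, and the
-- eigenvalues of a product multiply.
⊗-balanced : ∀ {c c′ A B} → Balanced c A → Balanced c′ B → Balanced (c′ ℤ.* c) (B ⊗ A)
⊗-balanced {c} {c′} {A} {B} balA balB k = begin
  (B ⊗ A) k 0F ℤ.+ (B ⊗ A) k 1F ℤ.+ (B ⊗ A) k 2F
    ≡⟨ solve 12 (λ x y z a b c d e f g h i →
         (x :* a :+ y :* d :+ z :* g) :+ (x :* b :+ y :* e :+ z :* h) :+ (x :* c :+ y :* f :+ z :* i)
         := x :* (a :+ b :+ c) :+ y :* (d :+ e :+ f) :+ z :* (g :+ h :+ i)) ≡.refl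
         (B k 0F) (B k 1F) (B k 2F) (A 0F 0F) (A 0F 1F) (A 0F 2F)
         (A 1F 0F) (A 1F 1F) (A 1F 2F) (A 2F 0F) (A 2F 1F) (A 2F 2F) ⟩
  B k 0F ℤ.* rowSum A 0F ℤ.+ B k 1F ℤ.* rowSum A 1F ℤ.+ B k 2F ℤ.* rowSum A 2F
    ≡⟨ ≡.cong₂ ℤ._+_ (≡.cong₂ ℤ._+_ (≡.cong (B k 0F ℤ.*_) (balA 0F)) (≡.cong (B k 1F ℤ.*_) (balA 1F)))
         (≡.cong (B k 2F ℤ.*_) (balA 2F)) ⟩
  B k 0F ℤ.* c ℤ.+ B k 1F ℤ.* c ℤ.+ B k 2F ℤ.* c
    ≡⟨ solve 4 (λ x y z c → x :* c :+ y :* c :+ z :* c := (x :+ y :+ z) :* c) ≡.refl (B k 0F) (B k 1F) (B k 2F) c ⟩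
  rowSum B k ℤ.* c
    ≡⟨ ≡.cong (ℤ._* c) (balB k) ⟩
  c′ ℤ.* c ∎
  where
  open ≡.≡-Reasoning
  open ℤSolver.+-*-Solver
  rowSum : Matrix → Fin 3 → ℤ
  rowSum M k = M k 0F ℤ.+ M k 1F ℤ.+ M k 2F

-- If a and b are the values of a functional at the vertices of two triangles,
-- these can only meet in the vertex m of the first or of the second one.
PointContactˡ PointContactʳ PointContact : (a b : Fin 3 → ℤ) → Set
PointContactˡ a b = ∃[ m ] ∀ k l → a k ℤ.≤ b l × (k ≡ m ⊎ a k ℤ.< b l)
PointContactʳ a b = ∃[ m ] ∀ k l → a k ℤ.≤ b l × (l ≡ m ⊎ a k ℤ.< b l)
PointContact a b = PointContactˡ a b ⊎ PointContactʳ a b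

pointContact? : ∀ a b → Dec (PointContact a b)
pointContact? a b =
  Fin.any? (λ m → Fin.all? λ k → Fin.all? λ l → a k ℤ.≤? b l ×-dec (k Fin.≟ m ⊎-dec a k ℤ.<? b l))
  ⊎-dec
  Fin.any? (λ m → Fin.all? λ k → Fin.all? λ l → a k ℤ.≤? b l ×-dec (l Fin.≟ m ⊎-dec a k ℤ.<? b l))

Separated : Matrix → Matrix → Set
Separated A B = Any (λ w → PointContact (A ⊙ w) (B ⊙ w)) directions

-- Meant for a closed first triangle and the interior of the second: an interior point has positive
-- weight at m, where the functional exceeds all its values on the first triangle.
StrictlySeparated : Matrix → Matrix → Set
StrictlySeparated A B =
  Any (λ w → ∃[ m ] ∀ k → (∀ l → (A ⊙ w) k ℤ.≤ (B ⊙ w) l) × (A ⊙ w) k ℤ.< (B ⊙ w) m) directions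

-- Both sides are coordinates with respect to one supertile, at scale 100. On the left is piece j of
-- the neighbour in position e, on the right the triangle in position f relative to piece i.
Neighbourly : Fin 12 → Fin 5 → Fin 5 → Fin 12 → Set
Neighbourly e i j f = piece j ⊗ neighbour e ≡ₘ neighbour f ⊗ piece i

Δ-vertices : Vec (ℤ × ℤ) 3
Δ-vertices = (+ 0 , + 0) ∷ (+ 2 , -[1+ 0 ]) ∷ (+ 2 , + 4) ∷ []

piece-vertices : Fin 5 → Vec (ℤ × ℤ) 3
piece-vertices 0F = (+ 2 , + 0) ∷ (+ 2 , -[1+ 0 ]) ∷ (+ 0 , + 0) ∷ []
piece-vertices 1F = (+ 1 , + 0) ∷ (+ 0 , + 0) ∷ (+ 1 , + 2) ∷ []
piece-vertices 2F = (+ 1 , + 0) ∷ (+ 2 , + 0) ∷ (+ 1 , + 2) ∷ []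
piece-vertices 3F = (+ 2 , + 2) ∷ (+ 1 , + 2) ∷ (+ 2 , + 0) ∷ []
piece-vertices 4F = (+ 2 , + 2) ∷ (+ 1 , + 2) ∷ (+ 2 , + 4) ∷ []

-- The third column is padding that lets `_⊗_` act on planar coordinates.
latticeMatrix : Vec (ℤ × ℤ) 3 → Matrix
latticeMatrix v k 0F = proj₁ (lookup v k)
latticeMatrix v k 1F = proj₂ (lookup v k)
latticeMatrix v k 2F = + 0

-- Finite checks by evaluation

abstract
  pieces-of-Δ : ∀ i k l →
    + 10 ℤ.* latticeMatrix (piece-vertices i) k l ≡ (piece i ⊗ latticeMatrix Δ-vertices) k l
  pieces-of-Δ = from-yes (Fin.all? λ i → Fin.all? λ k → Fin.all? λ l →
    + 10 ℤ.* latticeMatrix (piece-vertices i) k l ℤ.≟ (piece i ⊗ latticeMatrix Δ-vertices) k l)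

  neighbour-identity : scalar (+ 10) ≡ₘ neighbour 0F
  neighbour-identity = from-yes (scalar (+ 10) ≡ₘ? neighbour 0F)

  unpiece-piece : ∀ i → scalar (+ 20) ≡ₘ unpiece i ⊗ piece i
  unpiece-piece = from-yes (Fin.all? λ i → scalar (+ 20) ≡ₘ? (unpiece i ⊗ piece i))

  unpiece-balanced : ∀ i → Balanced (+ 2) (unpiece i)
  unpiece-balanced = from-yes (Fin.all? λ i → balanced? (+ 2) (unpiece i))

  neighbour-balanced : ∀ e → Balanced (+ 10) (neighbour e)
  neighbour-balanced = from-yes (Fin.all? λ e → balanced? (+ 10) (neighbour e))

  -- This and the next four facts describe the triple around the point (1,0) of Δ: the short legs of
  -- pieces 1 and 2 are the halves of the long leg of piece 0, and the long legs of pieces 1 and 2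
  -- coincide.
  right₁-midpoint : ∀ l → + 2 ℤ.* piece 1F 0F l ≡ piece 0F 0F l ℤ.+ piece 0F 2F l
  right₁-midpoint = from-yes (Fin.all? λ l → + 2 ℤ.* piece 1F 0F l ℤ.≟ piece 0F 0F l ℤ.+ piece 0F 2F l)

  short₁≡long₀ : ∀ l → piece 1F 1F l ≡ piece 0F 2F l
  short₁≡long₀ = from-yes (Fin.all? λ l → piece 1F 1F l ℤ.≟ piece 0F 2F l)

  right₂≡right₁ : ∀ l → piece 2F 0F l ≡ piece 1F 0F l
  right₂≡right₁ = from-yes (Fin.all? λ l → piece 2F 0F l ℤ.≟ piece 1F 0F l)

  short₂≡right₀ : ∀ l → piece 2F 1F l ≡ piece 0F 0F l
  short₂≡right₀ = from-yes (Fin.all? λ l → piece 2F 1F l ℤ.≟ piece 0F 0F l)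

  long₂≡long₁ : ∀ l → piece 2F 2F l ≡ piece 1F 2F l
  long₂≡long₁ = from-yes (Fin.all? λ l → piece 2F 2F l ℤ.≟ piece 1F 2F l)

  identity-contact : ∀ x → (x , x , 0F) ∈ₗ contacts 0F
  identity-contact 0F = here ≡.refl
  identity-contact 1F = there (here ≡.refl)
  identity-contact 2F = there (there (here ≡.refl))

  ⊕-identityʳ : ∀ a → a ≡ a ⊕ 0F
  ⊕-identityʳ = from-yes (Fin.all? λ a → a Fin.≟ (a ⊕ 0F))

  piece-balanced : ∀ i → Balanced (+ 10) (piece i)
  piece-balanced = from-yes (Fin.all? λ i → balanced? (+ 10) (piece i))

  piece-nonNegative : ∀ i k l → + 0 ℤ.≤ piece i k l
  piece-nonNegative = from-yes (Fin.all? λ i → Fin.all? λ k → Fin.all? λ l → + 0 ℤ.≤? piece i k l)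

  -- Every vertex of the supertile has weight in some vertex of each piece. Hence an interior point
  -- of a piece is interior to the supertile.
  piece-column≢0 : ∀ i l → ∃[ k ] piece i k l ≢ + 0
  piece-column≢0 = from-yes (Fin.all? λ i → Fin.all? λ l → Fin.any? λ k → ¬? (piece i k l ℤ.≟ + 0))

  -- Closure of the twelve positions under subdivision. The factor `scalar (+ 10)` brings piece i to
  -- the scale 100 of the product beside it.
  pieces-meet : ∀ e i j →
    Separated (scalar (+ 10) ⊗ piece i) (piece j ⊗ neighbour e) ⊎ ∃[ f ] Neighbourly e i j f
  pieces-meet = from-yes (Fin.all? λ e → Fin.all? λ i → Fin.all? λ j →
    Any.any? (λ w → pointContact? ((scalar (+ 10) ⊗ piece i) ⊙ w) ((piece j ⊗ neighbour e) ⊙ w)) directions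
    ⊎-dec Fin.any? (λ f → (piece j ⊗ neighbour e) ≡ₘ? (neighbour f ⊗ piece i)))

  -- From this, by induction, no tile of ωⁿ(K) meets the interior of another one.
  pieces-apart : ∀ i j → i ≡ j ⊎ StrictlySeparated (piece i) (piece j)
  pieces-apart = from-yes (Fin.all? λ i → Fin.all? λ j → i Fin.≟ j ⊎-dec
    Any.any? (λ w → Fin.any? λ m → Fin.all? λ k →
      (Fin.all? λ l → (piece i ⊙ w) k ℤ.≤? (piece j ⊙ w) l)
      ×-dec (piece i ⊙ w) k ℤ.<? (piece j ⊙ w) m) directions)

  -- If the parents have colours c and c ⊕ d, the pieces have colours c ⊕ `childShift i x` and c ⊕ d
  -- ⊕ `childShift j x′`. The final equation says that these differ by d′.
  contacts-descend : ∀ e → All (λ (x , x′ , d) → ∀ i j f → Neighbourly e i j f →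
      ∃[ d′ ] (childType i x , childType j x′ , d′) ∈ₗ contacts f
              × childShift i x ⊕ d′ ≡ d ⊕ childShift j x′)
    (contacts e)
  contacts-descend = from-yes (Fin.all? λ e → All.all? (λ (x , x′ , d) →
    Fin.all? λ i → Fin.all? λ j → Fin.all? λ f →
      ((piece j ⊗ neighbour e) ≡ₘ? (neighbour f ⊗ piece i)) →-dec
      Fin.any? λ d′ → ((childType i x , childType j x′ , d′) ∈? contacts f)
                  ×-dec (childShift i x ⊕ d′) Fin.≟ (d ⊕ childShift j x′)) (contacts e))
    where open DecMembership (≡-dec Fin._≟_ (≡-dec Fin._≟_ Fin._≟_)) using (_∈?_)

  contacts-change-colour : ∀ e → All (λ (_ , _ , d) → e ≡ 0F ⊎ d ≢ 0F) (contacts e)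
  contacts-change-colour = from-yes (Fin.all? λ e →
    All.all? (λ (_ , _ , d) → e Fin.≟ 0F ⊎-dec ¬? (d Fin.≟ 0F)) (contacts e))

  ⊕-assoc : ∀ a b c → a ⊕ b ⊕ c ≡ a ⊕ (b ⊕ c)
  ⊕-assoc = from-yes (Fin.all? λ a → Fin.all? λ b → Fin.all? λ c → (a ⊕ b ⊕ c) Fin.≟ (a ⊕ (b ⊕ c)))

  ⊕-fixed : ∀ a b → a ≡ a ⊕ b → b ≡ 0F
  ⊕-fixed = from-yes (Fin.all? λ a → Fin.all? λ b → (a Fin.≟ (a ⊕ b)) →-dec (b Fin.≟ 0F))

-- Enumeration of words

-- Binary numerals code lists of naturals: 1+[2_] pushes 0 and 2[1+_] increments
-- the head.
bump : List ℕ → List ℕ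
bump []      = []
bump (k ∷ l) = suc k ∷ l

decode : ℕᵇ → List ℕ
decode zero     = []
decode 1+[2 x ] = 0 ∷ decode x
decode 2[1+ x ] = bump (decode x)

encode-cons : ℕ → ℕᵇ → ℕᵇ
encode-cons zero    x = 1+[2 x ]
encode-cons (suc k) x = 2[1+ encode-cons k x ]

encode : List ℕ → ℕᵇ
encode []      = zero
encode (k ∷ l) = encode-cons k (encode l)

decode-encode : ∀ l → decode (encode l) ≡ l
decode-encode []      = ≡.refl
decode-encode (k ∷ l) = ≡.trans (cons k (encode l)) (≡.cong (k ∷_) (decode-encode l))
  where
  cons : ∀ k x → decode (encode-cons k x) ≡ k ∷ decode x
  cons zero    x = ≡.refl
  cons (suc k) x = ≡.cong bump (cons k x)

-- Total, with default 0: the enumeration `wordAt` only has to be surjective, so repeated words do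
-- no harm.
clamp : ∀ {n} → ℕ → Fin (suc n)
clamp {n} m with m ℕ.<? suc n
... | yes m<n = fromℕ< m<n
... | no  _   = zero

clamp-toℕ : ∀ {n} (i : Fin (suc n)) → clamp (toℕ i) ≡ i
clamp-toℕ {n} i with toℕ i ℕ.<? suc n
... | yes i<n = Fin.fromℕ<-toℕ i i<n
... | no  i≮n = contradiction (Fin.toℕ<n i) i≮n

Word : Set
Word = List (Fin 5 × Fin 5)

wordAt : ℕ → Word
wordAt n = map (λ k → remQuot 5 (clamp k)) (decode (ℕᵇ.fromℕ n))

wordAt-surjective : ∀ w → ∃[ n ] wordAt n ≡ w
wordAt-surjective w = ℕᵇ.toℕ (encode codes) , ≡.trans
  (≡.cong (λ x → map (λ k → remQuot 5 (clamp k)) (decode x)) (ℕᵇ.fromℕ-toℕ (encode codes)))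
  (≡.trans (≡.cong (map (λ k → remQuot 5 (clamp k))) (decode-encode codes)) (decode-codes w))
  where
  code : Fin 5 × Fin 5 → ℕ
  code (i , j) = toℕ (combine i j)
  codes = map code w
  decode-codes : ∀ w → map (λ k → remQuot {5} 5 (clamp k)) (map code w) ≡ w
  decode-codes []            = ≡.refl
  decode-codes ((i , j) ∷ w) = ≡.cong₂ _∷_
    (≡.trans (≡.cong (remQuot {5} 5) (clamp-toℕ (combine i j))) (Fin.remQuot-combine i j)) (decode-codes w)

-- A letter (i , j) goes up from the i-th piece of a tile, then down to the
-- j-th piece of the tile reached by the rest of the word.
wordScale : Word → ℤ
wordScale []      = + 10
wordScale (_ ∷ w) = + 10 ℤ.* (wordScale w ℤ.* + 2)

wordMatrix : Word → Matrix
wordMatrix []            = scalar (+ 10)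
wordMatrix ((i , j) ∷ w) = piece j ⊗ (wordMatrix w ⊗ unpiece i)

wordScale≢0 : ∀ w → wordScale w ≢ + 0
wordScale≢0 []      ()
wordScale≢0 (_ ∷ w) eq = [ (λ ()) , (λ eq → [ wordScale≢0 w , (λ ()) ]′ (ℤ.i*j≡0⇒i≡0∨j≡0 (wordScale w) eq)) ]′
  (ℤ.i*j≡0⇒i≡0∨j≡0 (+ 10) eq)

word-balanced : ∀ w → Balanced (wordScale w) (wordMatrix w)
word-balanced []            = from-yes (balanced? (+ 10) (scalar (+ 10)))
word-balanced ((i , j) ∷ w) = ⊗-balanced {A = wordMatrix w ⊗ unpiece i} {piece j}
  (⊗-balanced {A = unpiece i} {wordMatrix w} (unpiece-balanced i) (word-balanced w)) (piece-balanced j)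

-- König's lemma for three colours

module Compactness (em : ExcludedMiddle 0ℓ) (R : ℕ → ℕ → Fin 3 → Fin 3 → Set) where

  Colouring : Set
  Colouring = ℕ → Fin 3

  ProperBelow : ℕ → Colouring → Set
  ProperBelow n c = ∀ i j → i ℕ.< n → j ℕ.< n → R i j (c i) (c j)

  AgreeBelow : ℕ → Colouring → Colouring → Set
  AgreeBelow n c c′ = ∀ i → i ℕ.< n → c′ i ≡ c i

  -- In the tree of partial colourings, the node given by the first k values of c has proper
  -- descendants at every depth.
  Extendable : ℕ → Colouring → Set
  Extendable k c = ∀ n → ∃[ c′ ] AgreeBelow k c c′ × ProperBelow n c′

  -- Every value from k on becomes a; a prefix of length k + 1 sees only the one at k.
  _[_≔_] : Colouring → ℕ → Fin 3 → Colouring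
  (c [ k ≔ a ]) i with i ℕ.<? k
  ... | yes _ = c i
  ... | no _  = a

  ≔-below : ∀ c k a i → i ℕ.< k → (c [ k ≔ a ]) i ≡ c i
  ≔-below c k a i i<k with i ℕ.<? k
  ... | yes _  = ≡.refl
  ... | no i≮k = contradiction i<k i≮k

  ≔-at : ∀ c k a → (c [ k ≔ a ]) k ≡ a
  ≔-at c k a with k ℕ.<? k
  ... | yes k<k = contradiction k<k (ℕ.<-irrefl ≡.refl)
  ... | no _    = ≡.refl

  -- If each of the three values at k failed at some depth, let n be the largest of these depths.
  -- The extension c′ that is proper below n takes one of the three values at k, and so contradicts
  -- the failure of that value.
  extend : ∀ k c → Extendable k c → ∃[ c₁ ] AgreeBelow k c c₁ × Extendable (suc k) c₁
  extend k c ext with Fin.any? (λ a → em {Extendable (suc k) (c [ k ≔ a ])})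
  ... | yes (a , ext′) = c [ k ≔ a ] , ≔-below c k a , ext′
  ... | no  none       = contradiction impossible (bad (c′ k))
    where
    counterexample : ∀ a → ∃[ n ] ¬ (∃[ c′ ] AgreeBelow (suc k) (c [ k ≔ a ]) c′ × ProperBelow n c′)
    counterexample a with em {∃[ n ] ¬ (∃[ c′ ] AgreeBelow (suc k) (c [ k ≔ a ]) c′ × ProperBelow n c′)}
    ... | yes found = found
    ... | no ¬found = contradiction (a , λ n → em⇒dne em (λ ¬ext → ¬found (n , ¬ext))) none
    bound : Fin 3 → ℕ
    bound a = proj₁ (counterexample a)
    n = bound 0F ⊔ bound 1F ⊔ bound 2F
    bound≤n : ∀ a → bound a ℕ.≤ n
    bound≤n 0F = ℕ.≤-trans (ℕ.m≤m⊔n (bound 0F) (bound 1F)) (ℕ.m≤m⊔n _ (bound 2F))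
    bound≤n 1F = ℕ.≤-trans (ℕ.m≤n⊔m (bound 0F) (bound 1F)) (ℕ.m≤m⊔n _ (bound 2F))
    bound≤n 2F = ℕ.m≤n⊔m (bound 0F ⊔ bound 1F) (bound 2F)
    c′ = proj₁ (ext n)
    bad : ∀ a → ¬ (∃[ c′ ] AgreeBelow (suc k) (c [ k ≔ a ]) c′ × ProperBelow (bound a) c′)
    bad a = proj₂ (counterexample a)
    agree : AgreeBelow (suc k) (c [ k ≔ c′ k ]) c′
    agree i i<1+k with ℕ.m<1+n⇒m<n∨m≡n i<1+k
    ... | inj₁ i<k    = ≡.trans (proj₁ (proj₂ (ext n)) i i<k) (≡.sym (≔-below c k (c′ k) i i<k))
    ... | inj₂ ≡.refl = ≡.sym (≔-at c k (c′ k))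
    impossible : ∃[ c″ ] AgreeBelow (suc k) (c [ k ≔ c′ k ]) c″ × ProperBelow (bound (c′ k)) c″
    impossible = c′ , agree , λ i j i< j< → proj₂ (proj₂ (ext n)) i j
      (ℕ.<-≤-trans i< (bound≤n (c′ k))) (ℕ.<-≤-trans j< (bound≤n (c′ k)))

  compactness : (∀ n → ∃[ c ] ProperBelow n c) → ∃[ c ] ∀ i j → R i j (c i) (c j)
  compactness finite = limit , proper
    where
    stage : ∀ k → ∃[ c ] Extendable k c
    stage zero    = (λ _ → 0F) , λ n → proj₁ (finite n) , (λ _ ()) , proj₂ (finite n)
    stage (suc k) = proj₁ next , proj₂ (proj₂ next)
      where next = extend k (proj₁ (stage k)) (proj₂ (stage k))
    -- Stage k settles the values below k, so the value at i is read off at stage i + 1.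
    limit : Colouring
    limit i = proj₁ (stage (suc i)) i
    agree : ∀ k → AgreeBelow k limit (proj₁ (stage k))
    agree (suc k) i i<1+k with ℕ.m<1+n⇒m<n∨m≡n i<1+k
    ... | inj₁ i<k    = ≡.trans (proj₁ (proj₂ (extend k _ (proj₂ (stage k)))) i i<k) (agree k i i<k)
    ... | inj₂ ≡.refl = ≡.refl
    proper : ∀ i j → R i j (limit i) (limit j)
    -- For k above both indices, stage k has an extension that is proper below k; it agrees with the
    -- limit at i and at j.
    proper i j = ≡.subst₂ (R i j) (same i i<k) (same j j<k) (proj₂ (proj₂ (proj₂ (stage k) k)) i j i<k j<k)
      where
      k = suc (i ⊔ j)
      i<k = ℕ.s≤s (ℕ.m≤m⊔n i j)
      j<k = ℕ.s≤s (ℕ.m≤n⊔m i j)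
      same : ∀ m → m ℕ.< k → proj₁ (proj₂ (stage k) k) m ≡ limit m
      same m m<k = ≡.trans (proj₁ (proj₂ (proj₂ (stage k) k)) m m<k) (agree k m m<k)

-- Ordered fields

module Reals (ℝ : CompleteOrderedField) where
  open CompleteOrderedField ℝ public
  open IsTotalOrder isTotalOrder public
    using (antisym; total; ≤-respˡ-≈; ≤-respʳ-≈)
    renaming (refl to ≤-refl; trans to ≤-trans)
  open RingProperties ring public
    using (-‿distribˡ-*; -‿distribʳ-*; -‿involutive; -0#≈0#; -‿+-comm)
  open Mult semiring using (×-homo-+; ×1-homo-*)
  module ≈-Reasoning = SetoidReasoning setoid
  open ≈-Reasoning

  ι : ℤ → Carrier
  ι (+ n)    = fromℕ n
  ι -[1+ n ] = - fromℕ (suc n)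

  ι-cong : ∀ {i j} → i ≡ j → ι i ≈ ι j
  ι-cong ≡.refl = refl

  private
    cancel-suc : ∀ a b → a - b ≈ (1# + a) - (1# + b)
    cancel-suc a b = begin
      a - b                      ≈⟨ +-congʳ (+-identityˡ a) ⟨
      (0# + a) - b               ≈⟨ +-congʳ (+-congʳ (-‿inverseʳ 1#)) ⟨
      (1# - 1# + a) - b          ≈⟨ +-congʳ (+-assoc 1# (- 1#) a) ⟩
      (1# + (- 1# + a)) - b      ≈⟨ +-congʳ (+-congˡ (+-comm (- 1#) a)) ⟩
      (1# + (a - 1#)) - b        ≈⟨ +-congʳ (+-assoc 1# a (- 1#)) ⟨
      (1# + a - 1#) - b          ≈⟨ +-assoc (1# + a) (- 1#) (- b) ⟩
      (1# + a) + (- 1# - b)      ≈⟨ +-congˡ (-‿+-comm 1# b) ⟩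
      (1# + a) - (1# + b)        ∎

  ι-⊖ : ∀ m n → ι (m ⊖ n) ≈ fromℕ m - fromℕ n
  ι-⊖ m zero = sym (trans (+-congˡ -0#≈0#) (+-identityʳ _))
  ι-⊖ zero (suc n) = sym (+-identityˡ _)
  ι-⊖ (suc m) (suc n) = begin
    ι (suc m ⊖ suc n)             ≈⟨ ι-cong (ℤ.[1+m]⊖[1+n]≡m⊖n m n) ⟩
    ι (m ⊖ n)                     ≈⟨ ι-⊖ m n ⟩
    fromℕ m - fromℕ n             ≈⟨ cancel-suc _ _ ⟩
    fromℕ (suc m) - fromℕ (suc n) ∎

  ι-neg : ∀ i → ι (ℤ.- i) ≈ - ι i
  ι-neg (+ zero)  = sym -0#≈0#
  ι-neg (+ suc n) = refl
  ι-neg -[1+ n ]  = sym (-‿involutive _)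

  ι-+ : ∀ i j → ι (i ℤ.+ j) ≈ ι i + ι j
  ι-+ (+ m)    (+ n)    = ×-homo-+ 1# m n
  ι-+ (+ m)    -[1+ n ] = ι-⊖ m (suc n)
  ι-+ -[1+ m ] (+ n)    = trans (ι-⊖ n (suc m)) (+-comm _ _)
  ι-+ -[1+ m ] -[1+ n ] = begin
    - fromℕ (2 ℕ.+ (m ℕ.+ n))           ≈⟨ -‿cong (reflexive (≡.cong fromℕ (ℕ-suc m n))) ⟩
    - fromℕ (suc m ℕ.+ suc n)           ≈⟨ -‿cong (×-homo-+ 1# (suc m) (suc n)) ⟩
    - (fromℕ (suc m) + fromℕ (suc n))   ≈⟨ -‿+-comm _ _ ⟨
    - fromℕ (suc m) - fromℕ (suc n)     ∎
    where
    open import Data.Nat.Properties using (+-suc)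
    ℕ-suc : ∀ m n → 2 ℕ.+ (m ℕ.+ n) ≡ suc m ℕ.+ suc n
    ℕ-suc m n = ≡.cong suc (≡.sym (+-suc m n))

  private
    ι-*-pos : ∀ i n → ι (i ℤ.* + n) ≈ ι i * fromℕ n
    ι-*-pos (+ m) n = trans (ι-cong (≡.sym (ℤ.pos-* m n))) (×1-homo-* m n)
    ι-*-pos -[1+ m ] n = begin
      ι (-[1+ m ] ℤ.* + n)          ≈⟨ ι-cong (ℤ.neg-distribˡ-* (+ suc m) (+ n)) ⟨
      ι (ℤ.- (+ suc m ℤ.* + n))     ≈⟨ ι-neg (+ suc m ℤ.* + n) ⟩
      - ι (+ suc m ℤ.* + n)         ≈⟨ -‿cong (ι-*-pos (+ suc m) n) ⟩
      - (fromℕ (suc m) * fromℕ n)   ≈⟨ -‿distribˡ-* _ _ ⟩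
      - fromℕ (suc m) * fromℕ n     ∎

  ι-* : ∀ i j → ι (i ℤ.* j) ≈ ι i * ι j
  ι-* i (+ n) = ι-*-pos i n
  ι-* i -[1+ n ] = begin
    ι (i ℤ.* -[1+ n ])          ≈⟨ ι-cong (ℤ.neg-distribʳ-* i (+ suc n)) ⟨
    ι (ℤ.- (i ℤ.* + suc n))     ≈⟨ ι-neg (i ℤ.* + suc n) ⟩
    - ι (i ℤ.* + suc n)         ≈⟨ -‿cong (ι-*-pos i (suc n)) ⟩
    - (ι i * fromℕ (suc n))     ≈⟨ -‿distribʳ-* _ _ ⟩
    ι i * (- fromℕ (suc n))     ∎

  ι-1 : ι (+ 1) ≈ 1#
  ι-1 = +-identityʳ 1#

  private
    ι-morphism : ℤ.+-*-rawRing -Raw-AlmostCommutative⟶ fromCommutativeRing commutativeRing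
    ι-morphism = record
      { ⟦_⟧ = ι ; +-homo = ι-+ ; *-homo = ι-* ; -‿homo = ι-neg ; 0-homo = refl ; 1-homo = ι-1 }

    ι-≟ : ∀ i j → Maybe (ι i ≈ ι j)
    ι-≟ i j with i ℤ.≟ j
    ... | yes i≡j = just (ι-cong i≡j)
    ... | no  _   = nothing

  module Solver = RingSolver ℤ.+-*-rawRing (fromCommutativeRing commutativeRing) ι-morphism ι-≟
  open Solver public using (solve; con; _:+_; _:*_; _:-_; :-_; _:=_)

  x≤y⇒0≤y-x : ∀ {x y} → x ≤ y → 0# ≤ y - x
  x≤y⇒0≤y-x {x} x≤y = ≤-respˡ-≈ (-‿inverseʳ x) (+-monoˡ-≤ (- x) x≤y)

  +-nonNegative : ∀ {x y} → 0# ≤ x → 0# ≤ y → 0# ≤ x + y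
  +-nonNegative {x} {y} 0≤x 0≤y = ≤-trans 0≤y (≤-respˡ-≈ (+-identityˡ y) (+-monoˡ-≤ y 0≤x))

  0≤1 : 0# ≤ 1#
  0≤1 with total 0# 1#
  ... | inj₁ 0≤1 = 0≤1
  ... | inj₂ 1≤0 = ≤-respʳ-≈ square (*-nonNegative 0≤-1 0≤-1)
    where
    0≤-1 : 0# ≤ 0# - 1#
    0≤-1 = x≤y⇒0≤y-x 1≤0
    square : (0# - 1#) * (0# - 1#) ≈ 1#
    square = trans
      (solve 1 (λ u → (con (+ 0) :- u) :* (con (+ 0) :- u) := u :* u) refl 1#)
      (*-identityˡ 1#)

  0≤fromℕ : ∀ n → 0# ≤ fromℕ n
  0≤fromℕ zero    = ≤-refl
  0≤fromℕ (suc n) = +-nonNegative 0≤1 (0≤fromℕ n)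

  +-nonNegative-zeroˡ : ∀ {x y} → 0# ≤ x → 0# ≤ y → x + y ≈ 0# → x ≈ 0#
  +-nonNegative-zeroˡ {x} {y} 0≤x 0≤y x+y≈0 = antisym x≤0 0≤x
    where
    x≤0 : x ≤ 0#
    x≤0 = ≤-respʳ-≈ x+y≈0 (≤-respˡ-≈ (+-identityˡ x) (≤-respʳ-≈ (+-comm y x) (+-monoˡ-≤ x 0≤y)))

  +-nonNegative-zeroʳ : ∀ {x y} → 0# ≤ x → 0# ≤ y → x + y ≈ 0# → y ≈ 0#
  +-nonNegative-zeroʳ 0≤x 0≤y x+y≈0 = +-nonNegative-zeroˡ 0≤y 0≤x (trans (+-comm _ _) x+y≈0)

  fromℕ-suc≉0 : ∀ n → ¬ fromℕ (suc n) ≈ 0#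
  fromℕ-suc≉0 n 1+n≈0 = 0≉1 (sym (+-nonNegative-zeroˡ 0≤1 (0≤fromℕ n) 1+n≈0))

  0≤ι : ∀ {i} → + 0 ℤ.≤ i → 0# ≤ ι i
  0≤ι {+ n} (ℤ.+≤+ _) = 0≤fromℕ n

  ι≉0 : ∀ {i} → i ≢ + 0 → ¬ ι i ≈ 0#
  ι≉0 {+ zero}    i≢0 _    = i≢0 ≡.refl
  ι≉0 {+ suc n}   _   ιi≈0 = fromℕ-suc≉0 n ιi≈0
  ι≉0 { -[1+ n ]} _   ιi≈0 = fromℕ-suc≉0 n
    (trans (sym (-‿involutive _)) (trans (-‿cong ιi≈0) -0#≈0#))

  *-cancelˡ : ∀ {x y z} → ¬ x ≈ 0# → x * y ≈ x * z → y ≈ z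
  *-cancelˡ {x} {y} {z} x≉0 xy≈xz with inverse x x≉0
  ... | w , xw≈1 = begin
    y            ≈⟨ lemma y ⟩
    w * (x * y)  ≈⟨ *-congˡ xy≈xz ⟩
    w * (x * z)  ≈⟨ lemma z ⟨
    z            ∎
    where
    lemma : ∀ v → v ≈ w * (x * v)
    lemma v = begin
      v            ≈⟨ *-identityˡ v ⟨
      1# * v       ≈⟨ *-congʳ xw≈1 ⟨
      x * w * v    ≈⟨ solve 3 (λ x w v → x :* w :* v := w :* (x :* v)) refl x w v ⟩
      w * (x * v)  ∎

  *-zero-cancelˡ : ∀ {x y} → ¬ x ≈ 0# → x * y ≈ 0# → y ≈ 0#
  *-zero-cancelˡ x≉0 xy≈0 = *-cancelˡ x≉0 (trans xy≈0 (sym (zeroʳ _)))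

  x-y≈0⇒x≈y : ∀ {x y} → x - y ≈ 0# → x ≈ y
  x-y≈0⇒x≈y {x} {y} x-y≈0 = begin
    x            ≈⟨ solve 2 (λ x y → x := (x :- y) :+ y) refl x y ⟩
    (x - y) + y  ≈⟨ +-congʳ x-y≈0 ⟩
    0# + y       ≈⟨ +-identityˡ y ⟩
    y            ∎

  x≈y⇒x-y≈0 : ∀ {x y} → x ≈ y → x - y ≈ 0#
  x≈y⇒x-y≈0 {x} {y} x≈y = trans (+-congʳ x≈y) (-‿inverseʳ y)

  -- Makes √5 unique, so that all substitution steps share one ratio. As x is nonzero, x + y can be
  -- cancelled from (x + y)(x - y).
  square-injective : ∀ {x y} → 0# ≤ x → 0# ≤ y → ¬ x ≈ 0# → x * x ≈ y * y → x ≈ y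
  square-injective {x} {y} 0≤x 0≤y x≉0 x²≈y² = x-y≈0⇒x≈y (*-zero-cancelˡ x+y≉0 product)
    where
    x+y≉0 : ¬ x + y ≈ 0#
    x+y≉0 x+y≈0 = x≉0 (+-nonNegative-zeroˡ 0≤x 0≤y x+y≈0)
    product : (x + y) * (x - y) ≈ 0#
    product = trans
      (solve 2 (λ x y → (x :+ y) :* (x :- y) := x :* x :- y :* y) refl x y)
      (x≈y⇒x-y≈0 x²≈y²)

  -- If y ≤ 0, then 1 and x(-y) are non-negative with sum 0, which forces 1 = 0.
  0≤inverse : ∀ {x y} → 0# ≤ x → x * y ≈ 1# → 0# ≤ y
  0≤inverse {x} {y} 0≤x xy≈1 with total 0# y
  ... | inj₁ 0≤y = 0≤y
  ... | inj₂ y≤0 = contradiction (sym (+-nonNegative-zeroˡ 0≤1 0≤-xy 1-xy≈0)) 0≉1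
    where
    0≤-xy : 0# ≤ x * (0# - y)
    0≤-xy = *-nonNegative 0≤x (x≤y⇒0≤y-x y≤0)
    1-xy≈0 : 1# + x * (0# - y) ≈ 0#
    1-xy≈0 = trans
      (solve 3 (λ u x y → u :+ x :* (con (+ 0) :- y) := u :- x :* y) refl 1# x y)
      (x≈y⇒x-y≈0 (sym xy≈1))

  Vector : Set
  Vector = Fin 3 → Carrier

  ∑ : Vector → Carrier
  ∑ v = v 0F + v 1F + v 2F

  infix 8 _∙_
  _∙_ : Vector → Vector → Carrier
  v ∙ w = ∑ (λ k → v k * w k)

  infix 4 _≋_
  _≋_ : Vector → Vector → Set
  v ≋ w = ∀ k → v k ≈ w k

  ∑-cong : ∀ {v w} → v ≋ w → ∑ v ≈ ∑ w
  ∑-cong v≋w = +-cong (+-cong (v≋w 0F) (v≋w 1F)) (v≋w 2F)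

  ∙-congˡ : ∀ w {v v′} → v ≋ v′ → v ∙ w ≈ v′ ∙ w
  ∙-congˡ w v≋v′ = ∑-cong λ k → *-congʳ {w k} (v≋v′ k)

  ∙-congʳ : ∀ v {w w′} → w ≋ w′ → v ∙ w ≈ v ∙ w′
  ∙-congʳ v w≋w′ = ∑-cong λ k → *-congˡ {v k} (w≋w′ k)

  *-distribˡ-∑ : ∀ c v → c * ∑ v ≈ ∑ (λ k → c * v k)
  *-distribˡ-∑ c v = solve 4 (λ c x y z → c :* (x :+ y :+ z) := c :* x :+ c :* y :+ c :* z)
    refl c (v 0F) (v 1F) (v 2F)

  ∑-comm : ∀ (f : Fin 3 → Fin 3 → Carrier) → ∑ (λ k → ∑ (f k)) ≈ ∑ (λ l → ∑ (λ k → f k l))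
  ∑-comm f = solve 9
    (λ a b c d e f g h i → (a :+ b :+ c) :+ (d :+ e :+ f) :+ (g :+ h :+ i)
                        := (a :+ d :+ g) :+ (b :+ e :+ h) :+ (c :+ f :+ i)) refl
    (f 0F 0F) (f 0F 1F) (f 0F 2F) (f 1F 0F) (f 1F 1F) (f 1F 2F) (f 2F 0F) (f 2F 1F) (f 2F 2F)

  ∙-assoc : ∀ (v w : Vector) (M : Fin 3 → Vector) →
            v ∙ (λ k → M k ∙ w) ≈ (λ l → v ∙ (λ k → M k l)) ∙ w
  ∙-assoc v w M = begin
    ∑ (λ k → v k * ∑ (λ l → M k l * w l))
      ≈⟨ ∑-cong (λ k → *-distribˡ-∑ (v k) (λ l → M k l * w l)) ⟩
    ∑ (λ k → ∑ (λ l → v k * (M k l * w l)))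
      ≈⟨ ∑-comm (λ k l → v k * (M k l * w l)) ⟩
    ∑ (λ l → ∑ (λ k → v k * (M k l * w l)))
      ≈⟨ ∑-cong (λ l → ∑-cong λ k → solve 3 (λ x y z → x :* (y :* z) := z :* (x :* y)) refl
           (v k) (M k l) (w l)) ⟩
    ∑ (λ l → ∑ (λ k → w l * (v k * M k l)))
      ≈⟨ ∑-cong (λ l → *-distribˡ-∑ (w l) (λ k → v k * M k l)) ⟨
    ∑ (λ l → w l * (v ∙ (λ k → M k l)))
      ≈⟨ ∑-cong (λ l → *-comm (w l) (v ∙ (λ k → M k l))) ⟩
    ∑ (λ l → (v ∙ (λ k → M k l)) * w l)
      ∎

  ∙-scaleʳ : ∀ c v w → v ∙ (λ k → c * w k) ≈ c * (v ∙ w)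
  ∙-scaleʳ c v w = trans
    (∑-cong λ k → solve 3 (λ c x y → x :* (c :* y) := c :* (x :* y)) refl c (v k) (w k))
    (sym (*-distribˡ-∑ c (λ k → v k * w k)))

  ∙-scaleˡ : ∀ c v w → (λ k → c * v k) ∙ w ≈ c * (v ∙ w)
  ∙-scaleˡ c v w = trans
    (∑-cong λ k → *-assoc c (v k) (w k))
    (sym (*-distribˡ-∑ c (λ k → v k * w k)))

  ∙-sub : ∀ u v w → (λ k → u k - v k) ∙ w ≈ u ∙ w - v ∙ w
  ∙-sub u v w = solve 9 (λ a b c d e f x y z →
      (a :- d) :* x :+ (b :- e) :* y :+ (c :- f) :* z
      := (a :* x :+ b :* y :+ c :* z) :- (d :* x :+ e :* y :+ f :* z)) refl
    (u 0F) (u 1F) (u 2F) (v 0F) (v 1F) (v 2F) (w 0F) (w 1F) (w 2F)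

  ∙-shift : ∀ c v w → ∑ v ≈ 1# → v ∙ (λ k → w k - c) ≈ v ∙ w - c
  ∙-shift c v w ∑v≈1 = begin
    v ∙ (λ k → w k - c)  ≈⟨ solve 7 (λ c x y z a b d →
        x :* (a :- c) :+ y :* (b :- c) :+ z :* (d :- c)
        := (x :* a :+ y :* b :+ z :* d) :- (x :+ y :+ z) :* c) refl
        c (v 0F) (v 1F) (v 2F) (w 0F) (w 1F) (w 2F) ⟩
    v ∙ w - ∑ v * c      ≈⟨ +-congˡ (-‿cong (trans (*-congʳ ∑v≈1) (*-identityˡ c))) ⟩
    v ∙ w - c            ∎

  ∙-shift′ : ∀ c v w → ∑ v ≈ 1# → v ∙ (λ k → c - w k) ≈ c - v ∙ w
  ∙-shift′ c v w ∑v≈1 = begin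
    v ∙ (λ k → c - w k)  ≈⟨ solve 7 (λ c x y z a b d →
        x :* (c :- a) :+ y :* (c :- b) :+ z :* (c :- d)
        := (x :+ y :+ z) :* c :- (x :* a :+ y :* b :+ z :* d)) refl
        c (v 0F) (v 1F) (v 2F) (w 0F) (w 1F) (w 2F) ⟩
    ∑ v * c - v ∙ w      ≈⟨ +-congʳ (trans (*-congʳ ∑v≈1) (*-identityˡ c)) ⟩
    c - v ∙ w            ∎

  NonNegative : Vector → Set
  NonNegative v = ∀ k → 0# ≤ v k

  ∑-nonNegative : ∀ {v} → NonNegative v → 0# ≤ ∑ v
  ∑-nonNegative 0≤v = +-nonNegative (+-nonNegative (0≤v 0F) (0≤v 1F)) (0≤v 2F)

  ∑-nonNegative-zero : ∀ {v} → NonNegative v → ∑ v ≈ 0# → ∀ k → v k ≈ 0#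
  ∑-nonNegative-zero {v} 0≤v ∑v≈0 = λ where
      0F → +-nonNegative-zeroˡ (0≤v 0F) (0≤v 1F) initial
      1F → +-nonNegative-zeroʳ (0≤v 0F) (0≤v 1F) initial
      2F → +-nonNegative-zeroʳ (+-nonNegative (0≤v 0F) (0≤v 1F)) (0≤v 2F) ∑v≈0
    where
    initial : v 0F + v 1F ≈ 0#
    initial = +-nonNegative-zeroˡ (+-nonNegative (0≤v 0F) (0≤v 1F)) (0≤v 2F) ∑v≈0

  ∑≈1⇒≉0 : ∀ {v} → ∑ v ≈ 1# → ¬ (∀ k → v k ≈ 0#)
  ∑≈1⇒≉0 {v} ∑v≈1 v≈0 = 0≉1 (begin
    0#             ≈⟨ solve 0 (con (+ 0) := con (+ 0) :+ con (+ 0) :+ con (+ 0)) refl ⟩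
    0# + 0# + 0#   ≈⟨ ∑-cong v≈0 ⟨
    ∑ v            ≈⟨ ∑v≈1 ⟩
    1#             ∎)

  -- The double sum of the non-negative terms α k * β l * (b l - a k) vanishes.
  separation : ∀ (α β : Vector) (a b : Fin 3 → ℤ) →
    NonNegative α → NonNegative β → ∑ α ≈ 1# → ∑ β ≈ 1# →
    α ∙ (λ k → ι (a k)) ≈ β ∙ (λ k → ι (b k)) →
    (∀ k l → a k ℤ.≤ b l) →
    ∀ k l → ¬ α k ≈ 0# → a k ℤ.< b l → β l ≈ 0#
  separation α β a b 0≤α 0≤β ∑α≈1 ∑β≈1 means a≤b k l αk≉0 ak<bl =
    *-zero-cancelˡ (λ gap≈0 → ι≉0 (bl-ak≢0) (trans (ι-sub (a k) (b l)) gap≈0))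
      (trans (*-comm _ _) (inner-zero l))
    where
    ι-sub : ∀ i j → ι (j ℤ.- i) ≈ ι j - ι i
    ι-sub i j = trans (ι-+ j (ℤ.- i)) (+-congˡ (ι-neg i))

    bl-ak≢0 : b l ℤ.- a k ≢ + 0
    bl-ak≢0 eq = ℤ.<-irrefl (≡.sym (ℤ.i-j≡0⇒i≡j (b l) (a k) eq)) ak<bl

    gap : Fin 3 → Vector
    gap k l = ι (b l) - ι (a k)

    0≤gap : ∀ k → NonNegative (gap k)
    0≤gap k l = ≤-respʳ-≈ (ι-sub (a k) (b l)) (0≤ι (ℤ.i≤j⇒0≤j-i (a≤b k l)))

    mean : Carrier
    mean = β ∙ (λ l → ι (b l))

    0≤mean-a : ∀ k → 0# ≤ mean - ι (a k)
    0≤mean-a k = ≤-respʳ-≈ (∙-shift (ι (a k)) β (λ l → ι (b l)) ∑β≈1)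
      (∑-nonNegative λ l → *-nonNegative (0≤β l) (0≤gap k l))

    outer-zero : ∀ k → α k * (mean - ι (a k)) ≈ 0#
    outer-zero = ∑-nonNegative-zero (λ k → *-nonNegative (0≤α k) (0≤mean-a k))
      (trans (∙-shift′ mean α (λ k → ι (a k)) ∑α≈1) (x≈y⇒x-y≈0 (sym means)))

    inner-zero : ∀ l → β l * gap k l ≈ 0#
    inner-zero = ∑-nonNegative-zero (λ l → *-nonNegative (0≤β l) (0≤gap k l))
      (trans (∙-shift (ι (a k)) β (λ l → ι (b l)) ∑β≈1) (*-zero-cancelˡ αk≉0 (outer-zero k)))

-- Barycentric coordinates

module Geometry (em : ExcludedMiddle 0ℓ) (ℝ : CompleteOrderedField) where
  open Reals ℝ
  open Pinwheel ℝ
  open ≈-Reasoning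

  data Axis : Set where
    horizontal vertical : Axis

  coordinate : Axis → Point → Carrier
  coordinate horizontal = x-coord
  coordinate vertical   = y-coord

  vertex : Triangle → Fin 3 → Point
  vertex t 0F = right t
  vertex t 1F = short t
  vertex t 2F = long t

  ⟦_⟧ : Triangle → Axis → Vector
  ⟦ t ⟧ a k = coordinate a (vertex t k)

  ≈ₚ-intro : ∀ {p q} → (∀ a → coordinate a p ≈ coordinate a q) → p ≈ₚ q
  ≈ₚ-intro eq = eq horizontal , eq vertical

  ≈ₚ-elim : ∀ {p q} → p ≈ₚ q → ∀ a → coordinate a p ≈ coordinate a q
  ≈ₚ-elim (x , y) horizontal = x
  ≈ₚ-elim (x , y) vertical   = y

  ≈ₚ-sym : ∀ {p q} → p ≈ₚ q → q ≈ₚ p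
  ≈ₚ-sym (x , y) = sym x , sym y

  ≈ₚ-trans : ∀ {p q r} → p ≈ₚ q → q ≈ₚ r → p ≈ₚ r
  ≈ₚ-trans (x , y) (x′ , y′) = trans x x′ , trans y y′

  ≈ₜ-intro : ∀ {t u} → (∀ a → ⟦ t ⟧ a ≋ ⟦ u ⟧ a) → t ≈ₜ u
  ≈ₜ-intro eq = ≈ₚ-intro (λ a → eq a 0F) , ≈ₚ-intro (λ a → eq a 1F) , ≈ₚ-intro (λ a → eq a 2F)

  ≈ₜ-vertex : ∀ {t u} → t ≈ₜ u → ∀ k → vertex t k ≈ₚ vertex u k
  ≈ₜ-vertex (r , s , l) 0F = r
  ≈ₜ-vertex (r , s , l) 1F = s
  ≈ₜ-vertex (r , s , l) 2F = l

  ≈ₜ-elim : ∀ {t u} → t ≈ₜ u → ∀ a → ⟦ t ⟧ a ≋ ⟦ u ⟧ a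
  ≈ₜ-elim t≈u a k = ≈ₚ-elim (≈ₜ-vertex t≈u k) a

  ≈ₜ-refl : ∀ {t} → t ≈ₜ t
  ≈ₜ-refl = ≈ₜ-intro λ _ _ → refl

  ≈ₜ-sym : ∀ {t u} → t ≈ₜ u → u ≈ₜ t
  ≈ₜ-sym t≈u = ≈ₜ-intro λ a k → sym (≈ₜ-elim t≈u a k)

  ≈ₜ-trans : ∀ {t u v} → t ≈ₜ u → u ≈ₜ v → t ≈ₜ v
  ≈ₜ-trans t≈u u≈v = ≈ₜ-intro λ a k → trans (≈ₜ-elim t≈u a k) (≈ₜ-elim u≈v a k)

  ιᵥ : (Fin 3 → ℤ) → Vector
  ιᵥ v k = ι (v k)

  column : Matrix → Fin 3 → Vector
  column M l k = ι (M k l)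

  ι-⊗ : ∀ A B k l → ι ((A ⊗ B) k l) ≈ ιᵥ (A k) ∙ column B l
  ι-⊗ A B k l = ι-sum (A k) (λ m → B m l)
    where
    ι-sum : ∀ (v w : Fin 3 → ℤ) →
            ι (v 0F ℤ.* w 0F ℤ.+ v 1F ℤ.* w 1F ℤ.+ v 2F ℤ.* w 2F) ≈ ιᵥ v ∙ ιᵥ w
    ι-sum v w = begin
      ι (v 0F ℤ.* w 0F ℤ.+ v 1F ℤ.* w 1F ℤ.+ v 2F ℤ.* w 2F)
        ≈⟨ trans (ι-+ (v 0F ℤ.* w 0F ℤ.+ v 1F ℤ.* w 1F) (v 2F ℤ.* w 2F))
             (+-congʳ (ι-+ (v 0F ℤ.* w 0F) (v 1F ℤ.* w 1F))) ⟩
      ∑ (λ m → ι (v m ℤ.* w m))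
        ≈⟨ ∑-cong (λ m → ι-* (v m) (w m)) ⟩
      ιᵥ v ∙ ιᵥ w ∎

  ι-⊙ : ∀ A w k → ι ((A ⊙ w) k) ≈ ιᵥ (A k) ∙ ιᵥ (Vec.lookup w)
  ι-⊙ A (x ∷ y ∷ z ∷ []) k = ι-⊗ A (λ l _ → Vec.lookup (x ∷ y ∷ z ∷ []) l) k 0F

  -- The vertices of t are the affine combinations of those of s whose
  -- coefficients are the rows of M divided by c.
  Derived : ℤ → Matrix → Triangle → Triangle → Set
  Derived c M s t = ∀ a k → ι c * ⟦ t ⟧ a k ≈ ιᵥ (M k) ∙ ⟦ s ⟧ a

  Derived-cong : ∀ {c M s s′ t t′} → s ≈ₜ s′ → t ≈ₜ t′ → Derived c M s t → Derived c M s′ t′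
  Derived-cong {c} {M} s≈s′ t≈t′ d a k =
    trans (*-congˡ (sym (≈ₜ-elim t≈t′ a k))) (trans (d a k) (∙-congʳ (ιᵥ (M k)) (≈ₜ-elim s≈s′ a)))

  Derived-congₘ : ∀ {c M N s t} → M ≡ₘ N → Derived c M s t → Derived c N s t
  Derived-congₘ {s = s} M≡N d a k = trans (d a k) (∙-congˡ (⟦ s ⟧ a) λ l → ι-cong (M≡N k l))

  Derived-unique : ∀ {c M s t u} → c ≢ + 0 → Derived c M s t → Derived c M s u → t ≈ₜ u
  Derived-unique c≢0 d d′ = ≈ₜ-intro λ a k → *-cancelˡ (ι≉0 c≢0) (trans (d a k) (sym (d′ a k)))

  private
    ⊗-scaled : ∀ {c M s t} M′ → Derived c M s t → ∀ a k →
               ιᵥ ((M′ ⊗ M) k) ∙ ⟦ s ⟧ a ≈ ι c * (ιᵥ (M′ k) ∙ ⟦ t ⟧ a)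
    ⊗-scaled {c} {M} {s} {t} M′ d a k = begin
      ιᵥ ((M′ ⊗ M) k) ∙ ⟦ s ⟧ a                   ≈⟨ ∙-congˡ (⟦ s ⟧ a) (ι-⊗ M′ M k) ⟩
      (λ l → ιᵥ (M′ k) ∙ column M l) ∙ ⟦ s ⟧ a    ≈⟨ ∙-assoc (ιᵥ (M′ k)) (⟦ s ⟧ a) (λ m → ιᵥ (M m)) ⟨
      ιᵥ (M′ k) ∙ (λ m → ιᵥ (M m) ∙ ⟦ s ⟧ a)      ≈⟨ ∙-congʳ (ιᵥ (M′ k)) (d a) ⟨
      ιᵥ (M′ k) ∙ (λ m → ι c * ⟦ t ⟧ a m)         ≈⟨ ∙-scaleʳ (ι c) (ιᵥ (M′ k)) (⟦ t ⟧ a) ⟩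
      ι c * (ιᵥ (M′ k) ∙ ⟦ t ⟧ a)                 ∎

    reorder : ∀ c c′ x → ι (c′ ℤ.* c) * x ≈ ι c * (ι c′ * x)
    reorder c c′ x = trans (*-congʳ (ι-* c′ c))
      (solve 3 (λ c c′ x → c′ :* c :* x := c :* (c′ :* x)) refl (ι c) (ι c′) x)

  Derived-trans : ∀ {c M s t c′ M′ u} →
    Derived c M s t → Derived c′ M′ t u → Derived (c′ ℤ.* c) (M′ ⊗ M) s u
  Derived-trans {c} {M} {s} {t} {c′} {M′} {u} d d′ a k = begin
    ι (c′ ℤ.* c) * ⟦ u ⟧ a k      ≈⟨ reorder c c′ (⟦ u ⟧ a k) ⟩
    ι c * (ι c′ * ⟦ u ⟧ a k)      ≈⟨ *-congˡ (d′ a k) ⟩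
    ι c * (ιᵥ (M′ k) ∙ ⟦ t ⟧ a)   ≈⟨ ⊗-scaled {c} {M} {s} {t} M′ d a k ⟨
    ιᵥ ((M′ ⊗ M) k) ∙ ⟦ s ⟧ a     ∎

  -- The matrix from s to u is given as a product ending in M, so only the scalar c has to be
  -- divided out.
  Derived-cancel : ∀ {c M s t c′ M′ u} → c ≢ + 0 →
    Derived c M s t → Derived (c′ ℤ.* c) (M′ ⊗ M) s u → Derived c′ M′ t u
  Derived-cancel {c} {M} {s} {t} {c′} {M′} {u} c≢0 d d′ a k = *-cancelˡ (ι≉0 c≢0) (begin
    ι c * (ι c′ * ⟦ u ⟧ a k)      ≈⟨ reorder c c′ (⟦ u ⟧ a k) ⟨
    ι (c′ ℤ.* c) * ⟦ u ⟧ a k      ≈⟨ d′ a k ⟩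
    ιᵥ ((M′ ⊗ M) k) ∙ ⟦ s ⟧ a     ≈⟨ ⊗-scaled {c} {M} {s} {t} M′ d a k ⟩
    ι c * (ιᵥ (M′ k) ∙ ⟦ t ⟧ a)   ∎)

  ⟦dilate⟧ : ∀ r t a k → ⟦ dilate r t ⟧ a k ≡ r * ⟦ t ⟧ a k
  ⟦dilate⟧ r t horizontal = λ where 0F → ≡.refl ; 1F → ≡.refl ; 2F → ≡.refl
  ⟦dilate⟧ r t vertical   = λ where 0F → ≡.refl ; 1F → ≡.refl ; 2F → ≡.refl

  dilate-cong : ∀ {r r′ t t′} → r ≈ r′ → t ≈ₜ t′ → dilate r t ≈ₜ dilate r′ t′
  dilate-cong {r} {r′} {t} {t′} r≈r′ t≈t′ = ≈ₜ-intro λ a k → begin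
    ⟦ dilate r t ⟧ a k    ≡⟨ ⟦dilate⟧ r t a k ⟩
    r * ⟦ t ⟧ a k         ≈⟨ *-cong r≈r′ (≈ₜ-elim t≈t′ a k) ⟩
    r′ * ⟦ t′ ⟧ a k       ≡⟨ ⟦dilate⟧ r′ t′ a k ⟨
    ⟦ dilate r′ t′ ⟧ a k  ∎

  Derived-dilate : ∀ {c M s t} r → Derived c M s t → Derived c M (dilate r s) (dilate r t)
  Derived-dilate {c} {M} {s} {t} r d a k = begin
    ι c * ⟦ dilate r t ⟧ a k          ≡⟨ ≡.cong (ι c *_) (⟦dilate⟧ r t a k) ⟩
    ι c * (r * ⟦ t ⟧ a k)             ≈⟨ solve 3 (λ c r x → c :* (r :* x) := r :* (c :* x)) refl (ι c) r (⟦ t ⟧ a k) ⟩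
    r * (ι c * ⟦ t ⟧ a k)             ≈⟨ *-congˡ (d a k) ⟩
    r * (ιᵥ (M k) ∙ ⟦ s ⟧ a)          ≈⟨ ∙-scaleʳ r (ιᵥ (M k)) (⟦ s ⟧ a) ⟨
    ιᵥ (M k) ∙ (λ l → r * ⟦ s ⟧ a l)  ≈⟨ ∙-congʳ (ιᵥ (M k)) (λ l → reflexive (⟦dilate⟧ r s a l)) ⟨
    ιᵥ (M k) ∙ ⟦ dilate r s ⟧ a       ∎

  record Convex (t : Triangle) (z : Point) (α : Vector) : Set where
    field
      nonNegative : NonNegative α
      total-one   : ∑ α ≈ 1#
      position    : ∀ a → coordinate a z ≈ α ∙ ⟦ t ⟧ a
  open Convex public

  Positive : Vector → Set
  Positive α = ∀ k → ¬ α k ≈ 0#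

  In : Triangle → Pred Point 0ℓ
  In t z = Satisfiable (Convex t z)

  Inside : Triangle → Pred Point 0ℓ
  Inside t z = ∃[ α ] Convex t z α × Positive α

  vector : Carrier → Carrier → Carrier → Vector
  vector x y z 0F = x
  vector x y z 1F = y
  vector x y z 2F = z

  Closed⇒In : ∀ {t z} → Closed t z → In t z
  Closed⇒In (a , b , c , 0≤a , 0≤b , 0≤c , sum , pos) = vector a b c , record
    { nonNegative = λ where 0F → 0≤a ; 1F → 0≤b ; 2F → 0≤c
    ; total-one   = sum
    ; position    = λ where horizontal → proj₁ pos ; vertical → proj₂ pos
    }

  In-cong : ∀ {t u z y} → t ≈ₜ u → z ≈ₚ y → In t z → In u y
  In-cong t≈u z≈y (α , cx) = α , record
    { nonNegative = nonNegative cx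
    ; total-one   = total-one cx
    ; position    = λ a → trans (sym (≈ₚ-elim z≈y a)) (trans (position cx a) (∙-congʳ α (≈ₜ-elim t≈u a)))
    }

  -- Affine independence of the vertices, in the form that makes barycentric coordinates unique.
  Independent : Triangle → Set
  Independent t = ∀ δ → ∑ δ ≈ 0# → (∀ a → δ ∙ ⟦ t ⟧ a ≈ 0#) → ∀ k → δ k ≈ 0#

  Independent-cong : ∀ {t u} → t ≈ₜ u → Independent t → Independent u
  Independent-cong t≈u ind δ sum pos =
    ind δ sum λ a → trans (∙-congʳ δ (≈ₜ-elim t≈u a)) (pos a)

  ι-balanced : ∀ {c M} → Balanced c M → ∀ k → ∑ (ιᵥ (M k)) ≈ ι c
  ι-balanced {c} {M} bal k = trans
    (sym (trans (ι-+ (M k 0F ℤ.+ M k 1F) (M k 2F)) (+-congʳ (ι-+ (M k 0F) (M k 1F)))))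
    (ι-cong (bal k))

  ∑≈∙1 : ∀ v → ∑ v ≈ v ∙ (λ _ → 1#)
  ∑≈∙1 v = ∑-cong λ k → sym (*-identityʳ (v k))

  -- The row vector α M: weights at the vertices of a triangle derived from s become weights at the
  -- vertices of s, times the scale.
  pulled : Vector → Matrix → Vector
  pulled α M l = α ∙ column M l

  pulled-total : ∀ {α c M} → ∑ α ≈ 1# → Balanced c M → ∑ (pulled α M) ≈ ι c
  pulled-total {α} {c} {M} sum bal = begin
    ∑ (pulled α M)                       ≈⟨ ∑≈∙1 (pulled α M) ⟩
    pulled α M ∙ (λ _ → 1#)              ≈⟨ ∙-assoc α (λ _ → 1#) (λ k → ιᵥ (M k)) ⟨
    α ∙ (λ k → ιᵥ (M k) ∙ (λ _ → 1#))    ≈⟨ ∙-congʳ α (λ k → trans (sym (∑≈∙1 (ιᵥ (M k)))) (ι-balanced {c} {M} bal k)) ⟩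
    α ∙ (λ _ → ι c)                      ≈⟨ ∑-cong (λ k → *-comm (α k) (ι c)) ⟩
    ∑ (λ k → ι c * α k)                  ≈⟨ *-distribˡ-∑ (ι c) α ⟨
    ι c * ∑ α                            ≈⟨ *-congˡ sum ⟩
    ι c * 1#                             ≈⟨ *-identityʳ (ι c) ⟩
    ι c                                  ∎

  pulled-position : ∀ {c M s t z α} → Derived c M s t → Convex t z α →
                    ∀ a → ι c * coordinate a z ≈ pulled α M ∙ ⟦ s ⟧ a
  pulled-position {c} {M} {s} {t} {z} {α} d cx a = begin
    ι c * coordinate a z               ≈⟨ *-congˡ (position cx a) ⟩
    ι c * (α ∙ ⟦ t ⟧ a)                ≈⟨ ∙-scaleʳ (ι c) α (⟦ t ⟧ a) ⟨
    α ∙ (λ k → ι c * ⟦ t ⟧ a k)        ≈⟨ ∙-congʳ α (d a) ⟩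
    α ∙ (λ k → ιᵥ (M k) ∙ ⟦ s ⟧ a)     ≈⟨ ∙-assoc α (⟦ s ⟧ a) (λ k → ιᵥ (M k)) ⟩
    pulled α M ∙ ⟦ s ⟧ a               ∎

  Independent-unique : ∀ {t v w} → Independent t → ∑ v ≈ ∑ w →
                       (∀ a → v ∙ ⟦ t ⟧ a ≈ w ∙ ⟦ t ⟧ a) → v ≋ w
  Independent-unique {t} {v} {w} ind sum pos k = x-y≈0⇒x≈y (ind (λ k → v k - w k)
    (begin
      ∑ (λ k → v k - w k)               ≈⟨ ∑≈∙1 (λ k → v k - w k) ⟩
      (λ k → v k - w k) ∙ (λ _ → 1#)    ≈⟨ ∙-sub v w (λ _ → 1#) ⟩
      v ∙ (λ _ → 1#) - w ∙ (λ _ → 1#)   ≈⟨ x≈y⇒x-y≈0 (trans (sym (∑≈∙1 v)) (trans sum (∑≈∙1 w))) ⟩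
      0#                                ∎)
    (λ a → trans (∙-sub v w (⟦ t ⟧ a)) (x≈y⇒x-y≈0 (pos a))) k)

  -- Both sides are c times the value at z of the affine functional w on s, because z has only one
  -- system of coordinates with respect to s.
  same-mean : ∀ {c A B s t u z α β} → Independent s → Balanced c A → Balanced c B →
    Derived c A s t → Derived c B s u → Convex t z α → Convex u z β →
    ∀ w → α ∙ ιᵥ (A ⊙ w) ≈ β ∙ ιᵥ (B ⊙ w)
  same-mean {c} {A} {B} {s} {t} {u} {z} {α} {β} ind balA balB dA dB cα cβ w = begin
    α ∙ ιᵥ (A ⊙ w)                         ≈⟨ functional α A ⟩
    pulled α A ∙ ιᵥ (Vec.lookup w)         ≈⟨ ∙-congˡ (ιᵥ (Vec.lookup w)) weights ⟩
    pulled β B ∙ ιᵥ (Vec.lookup w)         ≈⟨ functional β B ⟨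
    β ∙ ιᵥ (B ⊙ w)                         ∎
    where
    functional : ∀ α A → α ∙ ιᵥ (A ⊙ w) ≈ pulled α A ∙ ιᵥ (Vec.lookup w)
    functional α A = trans (∙-congʳ α (ι-⊙ A w))
                           (∙-assoc α (ιᵥ (Vec.lookup w)) (λ k → ιᵥ (A k)))

    weights : pulled α A ≋ pulled β B
    weights = Independent-unique {s} ind
      (trans (pulled-total {α} {c} {A} (total-one cα) balA) (sym (pulled-total {β} {c} {B} (total-one cβ) balB)))
      (λ a → trans (sym (pulled-position {c} {A} {s} {t} {z} dA cα a)) (pulled-position {c} {B} {s} {u} {z} dB cβ a))

  -- Separation of triangles by functionals

  concentrated : ∀ {α m} → (∀ k → k ≢ m → α k ≈ 0#) → ∑ α ≈ 1# → ∀ v → α ∙ v ≈ v m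
  concentrated {α} {m} zero-off sum v = x-y≈0⇒x≈y (begin
    α ∙ v - v m               ≈⟨ ∙-shift (v m) α v sum ⟨
    α ∙ (λ k → v k - v m)     ≈⟨ ∑-cong term ⟩
    0# + 0# + 0#              ≈⟨ trans (+-congʳ (+-identityˡ 0#)) (+-identityˡ 0#) ⟩
    0#                        ∎)
    where
    term : ∀ k → α k * (v k - v m) ≈ 0#
    term k with k Fin.≟ m
    ... | yes ≡.refl = trans (*-congˡ (-‿inverseʳ (v k))) (zeroʳ (α k))
    ... | no  k≢m    = trans (*-congʳ (zero-off k k≢m)) (zeroˡ _)

  stable : ∀ {P : Set} → ¬ ¬ P → P
  stable = em⇒dne em

  module _ {α β : Vector} {a b : Fin 3 → ℤ}
    (0≤α : NonNegative α) (0≤β : NonNegative β) (∑α≈1 : ∑ α ≈ 1#) (∑β≈1 : ∑ β ≈ 1#)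
    (means : α ∙ ιᵥ a ≈ β ∙ ιᵥ b) where

    -- A nonzero weight at some k other than m would make every β l vanish by `separation`, although
    -- the β l add up to 1.
    contactˡ-weights : ((m , _) : PointContactˡ a b) → ∀ k → k ≢ m → α k ≈ 0#
    contactˡ-weights (m , contact) k k≢m = stable λ αk≉0 → ∑≈1⇒≉0 {β} ∑β≈1 λ l →
      separation α β a b 0≤α 0≤β ∑α≈1 ∑β≈1 means (λ k l → proj₁ (contact k l)) k l αk≉0 (strict l)
      where
      strict : ∀ l → a k ℤ.< b l
      strict l with proj₂ (contact k l)
      ... | inj₁ k≡m   = contradiction k≡m k≢m
      ... | inj₂ ak<bl = ak<bl

    contactʳ-weights : ((m , _) : PointContactʳ a b) → ∀ l → l ≢ m → β l ≈ 0#
    contactʳ-weights (m , contact) l l≢m = stable λ βl≉0 → ∑≈1⇒≉0 {α} ∑α≈1 λ k → stable λ αk≉0 → βl≉0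
      (separation α β a b 0≤α 0≤β ∑α≈1 ∑β≈1 means (λ k l → proj₁ (contact k l)) k l αk≉0 (strict k))
      where
      strict : ∀ k → a k ℤ.< b l
      strict k with proj₂ (contact k l)
      ... | inj₁ l≡m   = contradiction l≡m l≢m
      ... | inj₂ ak<bl = ak<bl

  -- Implied by a common segment, but better suited to induction: it passes from tiles to their
  -- parents and back along congruences, and it is already refuted by a point contact.
  Touch : Triangle → Triangle → Set
  Touch t u = ∃[ p ] ∃[ q ] ¬ p ≈ₚ q × (In t p × In u p) × (In t q × In u q)

  -- All the weight of a common point sits at the exceptional vertex, so any two common points
  -- coincide with that vertex.
  separated⇒¬touch : ∀ {c A B s t u} → Independent s → Balanced c A → Balanced c B →
    Derived c A s t → Derived c B s u → Separated A B → ¬ Touch t u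
  separated⇒¬touch {c} {A} {B} {s} {t} {u} ind balA balB dA dB sep
    (p , q , p≉q , ((α , cα) , (β , cβ)) , ((α′ , cα′) , (β′ , cβ′)))
    with Any.satisfied sep
  ... | w , inj₁ contact = p≉q (≈ₚ-intro λ a →
    trans (at cα cβ a) (sym (at cα′ cβ′ a)))
    where
    at : ∀ {z α β} → Convex t z α → Convex u z β → ∀ a → coordinate a z ≈ ⟦ t ⟧ a (proj₁ contact)
    at {z} {α} {β} cα cβ a = trans (position cα a) (concentrated {α}
      (contactˡ-weights {α} {β} {A ⊙ w} {B ⊙ w} (nonNegative cα) (nonNegative cβ) (total-one cα) (total-one cβ)
        (same-mean {c} {A} {B} {s} {t} {u} {z} ind balA balB dA dB cα cβ w) contact) (total-one cα) (⟦ t ⟧ a))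
  ... | w , inj₂ contact = p≉q (≈ₚ-intro λ a →
    trans (at cα cβ a) (sym (at cα′ cβ′ a)))
    where
    at : ∀ {z α β} → Convex t z α → Convex u z β → ∀ a → coordinate a z ≈ ⟦ u ⟧ a (proj₁ contact)
    at {z} {α} {β} cα cβ a = trans (position cβ a) (concentrated {β}
      (contactʳ-weights {α} {β} {A ⊙ w} {B ⊙ w} (nonNegative cα) (nonNegative cβ) (total-one cα) (total-one cβ)
        (same-mean {c} {A} {B} {s} {t} {u} {z} ind balA balB dA dB cα cβ w) contact) (total-one cβ) (⟦ u ⟧ a))

  strictlySeparated⇒disjoint : ∀ {c A B s t u z} → Independent s → Balanced c A → Balanced c B →
    Derived c A s t → Derived c B s u → StrictlySeparated A B → In t z → ¬ Inside u z
  strictlySeparated⇒disjoint {c} {A} {B} {s} {t} {u} {z} ind balA balB dA dB sep (α , cα) (β , cβ , pos)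
    with Any.satisfied sep
  ... | w , m , below = ∑≈1⇒≉0 {α} (total-one cα) λ k → stable λ αk≉0 → pos m
    (separation α β (A ⊙ w) (B ⊙ w) (nonNegative cα) (nonNegative cβ) (total-one cα) (total-one cβ)
      (same-mean {c} {A} {B} {s} {t} {u} {z} ind balA balB dA dB cα cβ w)
      (λ k → proj₁ (below k)) k m αk≉0 (proj₂ (below k)))

  open Congruence

  -- Congruences

  linear : Congruence → Axis → Carrier → Carrier → Carrier
  linear g a x y = x * coordinate a (column₁ g) + y * coordinate a (column₂ g)

  coordinate-move : ∀ g a p →
    coordinate a (move g p) ≡ linear g a (x-coord p) (y-coord p) + coordinate a (translation g)
  coordinate-move g horizontal p = ≡.refl
  coordinate-move g vertical   p = ≡.refl

  -- The inner products of the image with the two orthonormal columns recover x and y.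
  linear-kernel : ∀ g {x y} → (∀ a → linear g a x y ≈ 0#) → x ≈ 0# × y ≈ 0#
  linear-kernel g {x} {y} zero-image =
      trans (sym (trans (+-congʳ (*-congˡ unit₁≈)) (trans (+-congˡ (*-congˡ (orthogonal g))) (unitˡ x y))))
        (trans (expand₁ a b c d x y) (vanish a b))
    , trans (sym (trans (+-congˡ (*-congˡ unit₂≈)) (trans (+-congʳ (*-congˡ (orthogonal g))) (unitʳ x y))))
        (trans (expand₂ a b c d x y) (vanish c d))
    where
    a = x-coord (column₁ g)
    b = y-coord (column₁ g)
    c = x-coord (column₂ g)
    d = y-coord (column₂ g)
    unit₁≈ = unit₁ g
    unit₂≈ = unit₂ g
    unitˡ : ∀ x y → x * 1# + y * 0# ≈ x
    unitˡ x y = trans (+-cong (*-identityʳ x) (zeroʳ y)) (+-identityʳ x)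
    unitʳ : ∀ x y → x * 0# + y * 1# ≈ y
    unitʳ x y = trans (+-cong (zeroʳ x) (*-identityʳ y)) (+-identityˡ y)
    expand₁ : ∀ a b c d x y → x * (a * a + b * b) + y * (a * c + b * d)
                            ≈ a * (x * a + y * c) + b * (x * b + y * d)
    expand₁ = solve 6 (λ a b c d x y → x :* (a :* a :+ b :* b) :+ y :* (a :* c :+ b :* d)
                                    := a :* (x :* a :+ y :* c) :+ b :* (x :* b :+ y :* d)) refl
    expand₂ : ∀ a b c d x y → x * (a * c + b * d) + y * (c * c + d * d)
                            ≈ c * (x * a + y * c) + d * (x * b + y * d)
    expand₂ = solve 6 (λ a b c d x y → x :* (a :* c :+ b :* d) :+ y :* (c :* c :+ d :* d)
                                    := c :* (x :* a :+ y :* c) :+ d :* (x :* b :+ y :* d)) refl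
    vanish : ∀ p q → p * (x * a + y * c) + q * (x * b + y * d) ≈ 0#
    vanish p q = trans
      (+-cong (trans (*-congˡ (zero-image horizontal)) (zeroʳ p)) (trans (*-congˡ (zero-image vertical)) (zeroʳ q)))
      (+-identityˡ 0#)

  move-injective : ∀ g {p q} → move g p ≈ₚ move g q → p ≈ₚ q
  move-injective g {p} {q} eq = x-y≈0⇒x≈y (proj₁ kernel) , x-y≈0⇒x≈y (proj₂ kernel)
    where
    difference : ∀ a → linear g a (x-coord p - x-coord q) (y-coord p - y-coord q) ≈ 0#
    difference a = begin
      linear g a (x-coord p - x-coord q) (y-coord p - y-coord q)
        ≈⟨ solve 7 (λ x y x′ y′ c d τ → (x :- x′) :* c :+ (y :- y′) :* d
             := (x :* c :+ y :* d :+ τ) :- (x′ :* c :+ y′ :* d :+ τ)) refl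
             (x-coord p) (y-coord p) (x-coord q) (y-coord q)
             (coordinate a (column₁ g)) (coordinate a (column₂ g)) (coordinate a (translation g)) ⟩
      (linear g a (x-coord p) (y-coord p) + coordinate a (translation g))
        - (linear g a (x-coord q) (y-coord q) + coordinate a (translation g))
        ≈⟨ x≈y⇒x-y≈0 (trans (sym (reflexive (coordinate-move g a p)))
             (trans (≈ₚ-elim eq a) (reflexive (coordinate-move g a q)))) ⟩
      0# ∎
    kernel = linear-kernel g difference

  vertex-· : ∀ g t k → vertex (g · t) k ≡ move g (vertex t k)
  vertex-· g t 0F = ≡.refl
  vertex-· g t 1F = ≡.refl
  vertex-· g t 2F = ≡.refl

  ∙-⟦·⟧ : ∀ g t v a → v ∙ ⟦ g · t ⟧ a ≈
    linear g a (v ∙ ⟦ t ⟧ horizontal) (v ∙ ⟦ t ⟧ vertical) + ∑ v * coordinate a (translation g)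
  ∙-⟦·⟧ g t v a = begin
    v ∙ ⟦ g · t ⟧ a
      ≈⟨ ∙-congʳ v (λ k → reflexive (≡.trans
              (≡.cong (coordinate a) (vertex-· g t k)) (coordinate-move g a (vertex t k)))) ⟩
    v ∙ (λ k → linear g a (x-coord (vertex t k)) (y-coord (vertex t k)) + coordinate a (translation g))
      ≈⟨ solve 12 (λ u v w x y z x′ y′ z′ c d τ →
           u :* (x :* c :+ x′ :* d :+ τ) :+ v :* (y :* c :+ y′ :* d :+ τ) :+ w :* (z :* c :+ z′ :* d :+ τ)
           := ((u :* x :+ v :* y :+ w :* z) :* c :+ (u :* x′ :+ v :* y′ :+ w :* z′) :* d) :+ (u :+ v :+ w) :* τ) refl
           (v 0F) (v 1F) (v 2F) (⟦ t ⟧ horizontal 0F) (⟦ t ⟧ horizontal 1F) (⟦ t ⟧ horizontal 2F)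
           (⟦ t ⟧ vertical 0F) (⟦ t ⟧ vertical 1F) (⟦ t ⟧ vertical 2F)
           (coordinate a (column₁ g)) (coordinate a (column₂ g)) (coordinate a (translation g)) ⟩
    linear g a (v ∙ ⟦ t ⟧ horizontal) (v ∙ ⟦ t ⟧ vertical) + ∑ v * coordinate a (translation g) ∎

  linear-cong : ∀ g a {x x′ y y′} → x ≈ x′ → y ≈ y′ → linear g a x y ≈ linear g a x′ y′
  linear-cong g a x≈x′ y≈y′ = +-cong (*-congʳ x≈x′) (*-congʳ y≈y′)

  -- The weights add up to c, so the translation enters both sides with the same factor. Keeping c
  -- general covers integer rows before division.
  move-affine : ∀ g t {z v c} → ∑ v ≈ c → (∀ a → c * coordinate a z ≈ v ∙ ⟦ t ⟧ a) →
                ∀ a → c * coordinate a (move g z) ≈ v ∙ ⟦ g · t ⟧ a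
  move-affine g t {z} {v} {c} sum pos a = begin
    c * coordinate a (move g z)
      ≡⟨ ≡.cong (c *_) (coordinate-move g a z) ⟩
    c * (linear g a (x-coord z) (y-coord z) + coordinate a (translation g))
      ≈⟨ solve 6 (λ c x y p q τ → c :* (x :* p :+ y :* q :+ τ) := (c :* x) :* p :+ (c :* y) :* q :+ c :* τ) refl
           c (x-coord z) (y-coord z)
           (coordinate a (column₁ g)) (coordinate a (column₂ g)) (coordinate a (translation g)) ⟩
    linear g a (c * x-coord z) (c * y-coord z) + c * coordinate a (translation g)
      ≈⟨ +-cong (linear-cong g a (pos horizontal) (pos vertical)) (*-congʳ (sym sum)) ⟩
    linear g a (v ∙ ⟦ t ⟧ horizontal) (v ∙ ⟦ t ⟧ vertical) + ∑ v * coordinate a (translation g)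
      ≈⟨ ∙-⟦·⟧ g t v a ⟨
    v ∙ ⟦ g · t ⟧ a ∎

  -- Weights of sum zero remove the translation, which leaves `linear-kernel`.
  Independent-· : ∀ {t} g → Independent t → Independent (g · t)
  Independent-· {t} g ind δ sum pos = ind δ sum λ where
      horizontal → proj₁ kernel
      vertical   → proj₂ kernel
    where
    kernel = linear-kernel g λ a → begin
      linear g a (δ ∙ ⟦ t ⟧ horizontal) (δ ∙ ⟦ t ⟧ vertical)
        ≈⟨ trans (+-congˡ (trans (*-congʳ sum) (zeroˡ (coordinate a (translation g))))) (+-identityʳ _) ⟨
      linear g a (δ ∙ ⟦ t ⟧ horizontal) (δ ∙ ⟦ t ⟧ vertical) + ∑ δ * coordinate a (translation g)
        ≈⟨ ∙-⟦·⟧ g t δ a ⟨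
      δ ∙ ⟦ g · t ⟧ a
        ≈⟨ pos a ⟩
      0# ∎

  Derived-· : ∀ {c M s t} g → Balanced c M → Derived c M s t → Derived c M (g · s) (g · t)
  Derived-· {c} {M} {s} {t} g bal d a k = trans
    (reflexive (≡.cong (λ p → ι c * coordinate a p) (vertex-· g t k)))
    (move-affine g s {vertex t k} {ιᵥ (M k)} (ι-balanced {c} {M} bal k) (λ a → d a k) a)

  Convex-· : ∀ {t z α} g → Convex t z α → Convex (g · t) (move g z) α
  Convex-· {t} {z} {α} g cx = record
    { nonNegative = nonNegative cx
    ; total-one   = total-one cx
    ; position    = λ a → trans (sym (*-identityˡ _))
        (move-affine g t {z} {α} (total-one cx) (λ a → trans (*-identityˡ _) (position cx a)) a)
    }

  combination : (t : Triangle) (α : Vector) → Point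
  combination t α = ⟨ α ∙ ⟦ t ⟧ horizontal , α ∙ ⟦ t ⟧ vertical ⟩

  convex-point : ∀ t {α} → NonNegative α → ∑ α ≈ 1# → Convex t (combination t α) α
  convex-point t 0≤α sum = record
    { nonNegative = 0≤α
    ; total-one   = sum
    ; position    = λ where horizontal → refl ; vertical → refl
    }

  In-·⁻ : ∀ {t z} g → In (g · t) z → ∃[ y ] z ≈ₚ move g y × In t y
  In-·⁻ {t} {z} g (α , cx) = y , ≈ₚ-intro (λ a → trans (position cx a) (sym (position (Convex-· g cy) a))) , α , cy
    where
    y = combination t α
    cy = convex-point t (nonNegative cx) (total-one cx)

  lattice : Vec (ℤ × ℤ) 3 → Triangle
  lattice ((a , b) ∷ (c , d) ∷ (e , f) ∷ []) = triangle ⟨ ι a , ι b ⟩ ⟨ ι c , ι d ⟩ ⟨ ι e , ι f ⟩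

  ⟦lattice⟧ : ∀ v k → ⟦ lattice v ⟧ horizontal k ≡ ι (latticeMatrix v k 0F)
                    × ⟦ lattice v ⟧ vertical k ≡ ι (latticeMatrix v k 1F)
  ⟦lattice⟧ (_ ∷ _ ∷ _ ∷ []) 0F = ≡.refl , ≡.refl
  ⟦lattice⟧ (_ ∷ _ ∷ _ ∷ []) 1F = ≡.refl , ≡.refl
  ⟦lattice⟧ (_ ∷ _ ∷ _ ∷ []) 2F = ≡.refl , ≡.refl

  Derived-lattice : ∀ {c M} v w →
    (∀ k l → c ℤ.* latticeMatrix w k l ≡ (M ⊗ latticeMatrix v) k l) → Derived c M (lattice v) (lattice w)
  Derived-lattice {c} {M} v w eq = λ where
      horizontal k → along 0F horizontal (λ v k → proj₁ (⟦lattice⟧ v k)) k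
      vertical   k → along 1F vertical (λ v k → proj₂ (⟦lattice⟧ v k)) k
    where
    along : ∀ l a → (∀ v k → ⟦ lattice v ⟧ a k ≡ ι (latticeMatrix v k l)) →
            ∀ k → ι c * ⟦ lattice w ⟧ a k ≈ ιᵥ (M k) ∙ ⟦ lattice v ⟧ a
    along l a coord k = begin
      ι c * ⟦ lattice w ⟧ a k               ≡⟨ ≡.cong (ι c *_) (coord w k) ⟩
      ι c * ι (latticeMatrix w k l)         ≈⟨ ι-* c (latticeMatrix w k l) ⟨
      ι (c ℤ.* latticeMatrix w k l)         ≈⟨ ι-cong (eq k l) ⟩
      ι ((M ⊗ latticeMatrix v) k l)         ≈⟨ ι-⊗ M (latticeMatrix v) k l ⟩
      ιᵥ (M k) ∙ column (latticeMatrix v) l ≈⟨ ∙-congʳ (ιᵥ (M k)) (λ m → reflexive (coord v m)) ⟨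
      ιᵥ (M k) ∙ ⟦ lattice v ⟧ a            ∎

  ι-[-1] : ι -[1+ 0 ] ≈ - 1#
  ι-[-1] = -‿cong (+-identityʳ 1#)

  Δ-lattice : lattice Δ-vertices ≈ₜ Δ
  Δ-lattice = (refl , refl) , (refl , ι-[-1]) , (refl , refl)

  piece-lattice : ∀ i → lattice (piece-vertices i) ≈ₜ List.lookup dissection i
  piece-lattice 0F = (refl , refl) , (refl , ι-[-1]) , (refl , refl)
  piece-lattice 1F = (refl , refl) , (refl , refl) , (refl , refl)
  piece-lattice 2F = (refl , refl) , (refl , refl) , (refl , refl)
  piece-lattice 3F = (refl , refl) , (refl , refl) , (refl , refl)
  piece-lattice 4F = (refl , refl) , (refl , refl) , (refl , refl)

  Derived-piece : ∀ i → Derived (+ 10) (piece i) Δ (List.lookup dissection i)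
  Derived-piece i = Derived-cong {+ 10} {piece i} Δ-lattice (piece-lattice i)
    (Derived-lattice {+ 10} {piece i} Δ-vertices (piece-vertices i) (pieces-of-Δ i))

  Independent-Δ : Independent Δ
  Independent-Δ = Independent-cong Δ-lattice independent
    where
    independent : Independent (lattice Δ-vertices)
    independent δ sum pos = λ where
        0F → trans (sym (trans (+-cong (trans (+-congˡ y≈0) (+-identityʳ x)) z≈0) (+-identityʳ x))) sum
        1F → y≈0
        2F → z≈0
      where
      x = δ 0F
      y = δ 1F
      z = δ 2F
      X = x * ι (+ 0) + y * ι (+ 2) + z * ι (+ 2)
      Y = x * ι (+ 0) + y * ι -[1+ 0 ] + z * ι (+ 4)
      X′ = λ {n} (x y z : Solver.Polynomial n) → x :* con (+ 0) :+ y :* con (+ 2) :+ z :* con (+ 2)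
      Y′ = λ {n} (x y z : Solver.Polynomial n) → x :* con (+ 0) :+ y :* con -[1+ 0 ] :+ z :* con (+ 4)
      vanish : ∀ m n → ι m * X + ι n * Y ≈ 0#
      vanish m n = trans (+-cong (trans (*-congˡ (pos horizontal)) (zeroʳ _)) (trans (*-congˡ (pos vertical)) (zeroʳ _)))
        (+-identityˡ 0#)
      -- The multipliers (4, -2) and (1, 2) eliminate z and y respectively; 10 is the determinant of
      -- the edge vectors (2, -1) and (2, 4).
      y≈0 : y ≈ 0#
      y≈0 = *-zero-cancelˡ {ι (+ 10)} (ι≉0 {+ 10} λ ()) (trans
        (solve 3 (λ x y z → con (+ 10) :* y := con (+ 4) :* X′ x y z :+ con -[1+ 1 ] :* Y′ x y z) refl x y z)
        (vanish (+ 4) -[1+ 1 ]))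
      z≈0 : z ≈ 0#
      z≈0 = *-zero-cancelˡ {ι (+ 10)} (ι≉0 {+ 10} λ ()) (trans
        (solve 3 (λ x y z → con (+ 10) :* z := con (+ 1) :* X′ x y z :+ con (+ 2) :* Y′ x y z) refl x y z)
        (vanish (+ 1) (+ 2)))

  -- Supertiles

  -- The affine content of `substitute`: its congruence is forgotten, and only the nondegenerate
  -- inflated tile and the coordinates of the piece remain.
  record IsChild (i : Fin 5) (s t : Triangle) : Set where
    field
      ratio        : Carrier
      0≤ratio      : 0# ≤ ratio
      ratio²≈5     : ratio * ratio ≈ fromℕ 5
      independent  : Independent (dilate ratio s)
      derived      : Derived (+ 10) (piece i) (dilate ratio s) t

    ratio≉0 : ¬ ratio ≈ 0#
    ratio≉0 r≈0 = fromℕ-suc≉0 4 (trans (sym ratio²≈5) (trans (*-congʳ r≈0) (zeroˡ ratio)))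

  substitute⇒child : ∀ {s t} → substitute s t → ∃[ i ] IsChild i s t
  substitute⇒child {s} {t} (r , g , 0≤r , r²≈5 , gΔ≈rs , some) = Any.index some , record
    { ratio       = r
    ; 0≤ratio     = 0≤r
    ; ratio²≈5    = r²≈5
    ; independent = Independent-cong gΔ≈rs (Independent-· {Δ} g Independent-Δ)
    ; derived     = Derived-cong {+ 10} {piece (Any.index some)} gΔ≈rs (≈ₜ-sym (lookup-index some))
        (Derived-· {+ 10} {piece (Any.index some)} {Δ} g
          (piece-balanced (Any.index some)) (Derived-piece (Any.index some)))
    }

  -- A relation and not a function, since a tile might come from several parents; `same-label` shows
  -- that the state is unique at each level.
  data Labelled : ℕ → Triangle → State → Set where
    base : ∀ {t} → t ≈ₜ K → Labelled 0 t (0F , 0F)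
    step : ∀ {n s q i t} → Labelled n s q → IsChild i s t → Labelled (suc n) t (child i q)

  labelled : ∀ n {t} → ωⁿK n t → ∃[ q ] Labelled n t q
  labelled zero    t≈K = _ , base t≈K
  labelled (suc n) (s , s∈ωⁿK , sub) = _ , step (proj₂ (labelled n s∈ωⁿK)) (proj₂ (substitute⇒child sub))

  ratio-unique : ∀ {i j s s′ t t′} (c : IsChild i s t) (c′ : IsChild j s′ t′) → IsChild.ratio c ≈ IsChild.ratio c′
  ratio-unique c c′ = square-injective (0≤ratio c) (0≤ratio c′) (ratio≉0 c) (trans (ratio²≈5 c) (sym (ratio²≈5 c′)))
    where open IsChild

  *ₚ-injective : ∀ {r r′ p p′} → r ≈ r′ → ¬ r ≈ 0# → r *ₚ p ≈ₚ r′ *ₚ p′ → p ≈ₚ p′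
  *ₚ-injective r≈r′ r≉0 (x , y) =
    *-cancelˡ r≉0 (trans x (*-congʳ (sym r≈r′))) , *-cancelˡ r≉0 (trans y (*-congʳ (sym r≈r′)))

  tenth : ∃[ y ] ι (+ 10) * y ≈ 1#
  tenth = inverse (ι (+ 10)) (ι≉0 {+ 10} λ ())

  module _ {i s t} (c : IsChild i s t) where
    open IsChild c

    -- Weights of a point of the piece, rewritten at the vertices of the supertile. Used in the
    -- undilated tile s they give that point divided by √5, which is `parentPoint`.
    parentWeights : Vector → Vector
    parentWeights α l = proj₁ tenth * pulled α (piece i) l

    parentPoint : Vector → Point
    parentPoint α = combination s (parentWeights α)

    0≤tenth : 0# ≤ proj₁ tenth
    0≤tenth = 0≤inverse (0≤fromℕ 10) (proj₂ tenth)

    term-nonNegative : ∀ {α} → NonNegative α → ∀ l → NonNegative (λ k → α k * ι (piece i k l))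
    term-nonNegative 0≤α l k = *-nonNegative (0≤α k) (0≤ι (piece-nonNegative i k l))

    tenth-cancel : ∀ x → proj₁ tenth * (ι (+ 10) * x) ≈ x
    tenth-cancel x = begin
      proj₁ tenth * (ι (+ 10) * x)  ≈⟨ *-assoc _ _ x ⟨
      proj₁ tenth * ι (+ 10) * x    ≈⟨ *-congʳ (trans (*-comm _ _) (proj₂ tenth)) ⟩
      1# * x                        ≈⟨ *-identityˡ x ⟩
      x                             ∎

    parent-convex : ∀ {z α} → Convex t z α → Convex s (parentPoint α) (parentWeights α)
    parent-convex {z} {α} cx = convex-point s
      (λ l → *-nonNegative 0≤tenth (∑-nonNegative (term-nonNegative (nonNegative cx) l)))
      (begin
        ∑ (parentWeights α)                  ≈⟨ *-distribˡ-∑ (proj₁ tenth) (pulled α (piece i)) ⟨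
        proj₁ tenth * ∑ (pulled α (piece i)) ≈⟨ *-congˡ (pulled-total {α} {+ 10} {piece i} (total-one cx) (piece-balanced i)) ⟩
        proj₁ tenth * ι (+ 10)               ≈⟨ trans (*-comm _ _) (proj₂ tenth) ⟩
        1#                                   ∎)

    parent-position : ∀ {z α} → Convex t z α → z ≈ₚ ratio *ₚ parentPoint α
    parent-position {z} {α} cx = along horizontal , along vertical
      where
      along : ∀ a → coordinate a z ≈ ratio * (parentWeights α ∙ ⟦ s ⟧ a)
      along a = begin
        coordinate a z
          ≈⟨ tenth-cancel (coordinate a z) ⟨
        proj₁ tenth * (ι (+ 10) * coordinate a z)
          ≈⟨ *-congˡ (pulled-position {+ 10} {piece i} {dilate ratio s} {t} {z} {α} derived cx a) ⟩
        proj₁ tenth * (pulled α (piece i) ∙ ⟦ dilate ratio s ⟧ a)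
          ≈⟨ ∙-scaleˡ (proj₁ tenth) (pulled α (piece i)) (⟦ dilate ratio s ⟧ a) ⟨
        parentWeights α ∙ ⟦ dilate ratio s ⟧ a
          ≈⟨ ∙-congʳ (parentWeights α) (λ k → reflexive (⟦dilate⟧ ratio s a k)) ⟩
        parentWeights α ∙ (λ k → ratio * ⟦ s ⟧ a k)
          ≈⟨ ∙-scaleʳ ratio (parentWeights α) (⟦ s ⟧ a) ⟩
        ratio * (parentWeights α ∙ ⟦ s ⟧ a) ∎

    parent-positive : ∀ {α} → NonNegative α → Positive α → Positive (parentWeights α)
    parent-positive {α} 0≤α pos l zero-weight with piece-column≢0 i l
    ... | k , entry≢0 = pos k (*-zero-cancelˡ (ι≉0 entry≢0) (trans (*-comm _ _)
      (∑-nonNegative-zero (term-nonNegative 0≤α l) (*-zero-cancelˡ tenth≉0 zero-weight) k)))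
      where
      tenth≉0 : ¬ proj₁ tenth ≈ 0#
      tenth≉0 eq = 0≉1 (trans (sym (trans (*-congˡ eq) (zeroʳ _))) (proj₂ tenth))

    In-parent : ∀ {z} → In t z → ∃[ y ] z ≈ₚ ratio *ₚ y × In s y
    In-parent (α , cx) = parentPoint α , parent-position cx , _ , parent-convex cx

    Inside-parent : ∀ {z} → Inside t z → ∃[ y ] z ≈ₚ ratio *ₚ y × Inside s y
    Inside-parent (α , cx , pos) =
      parentPoint α , parent-position cx , _ , parent-convex cx , parent-positive (nonNegative cx) pos

  open IsChild

  common-point : ∀ {i j s s′ t t′ y y′ z} (c : IsChild i s t) (c′ : IsChild j s′ t′) →
    z ≈ₚ ratio c *ₚ y → z ≈ₚ ratio c′ *ₚ y′ → y ≈ₚ y′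
  common-point c c′ z≈ry z≈r′y′ =
    *ₚ-injective (ratio-unique c c′) (ratio≉0 c) (≈ₚ-trans (≈ₚ-sym z≈ry) z≈r′y′)

  child-of-same : ∀ {i j s s′ t u} (c : IsChild i s t) (c′ : IsChild j s′ u) → s ≈ₜ s′ →
    Derived (+ 10) (piece j) (dilate (ratio c) s) u
  child-of-same {j = j} c c′ s≈s′ = Derived-cong {+ 10} {piece j}
    (≈ₜ-sym (dilate-cong (ratio-unique c c′) s≈s′)) ≈ₜ-refl (derived c′)

  -- Divided by √5, the point z lies in s and inside s′, so the parents and their states agree by
  -- induction. Then `pieces-apart` leaves only i = j.
  packing-step : ∀ {i j s s′ t u q q′ z} → IsChild i s t → IsChild j s′ u →
    (∀ {y} → In s y → Inside s′ y → s ≈ₜ s′ × q ≡ q′) →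
    In t z → Inside u z → t ≈ₜ u × child i q ≡ child j q′
  packing-step {i} {j} {s} {s′} {t} {u} {q} {q′} {z} c c′ packed in-t inside-u =
    conclude (pieces-apart i j)
    where
    below = In-parent c in-t
    below′ = Inside-parent c′ inside-u
    same : s ≈ₜ s′ × q ≡ q′
    same = packed (In-cong ≈ₜ-refl (common-point c c′ (proj₁ (proj₂ below)) (proj₁ (proj₂ below′)))
                            (proj₂ (proj₂ below)))
                  (proj₂ (proj₂ below′))
    derived′ : Derived (+ 10) (piece j) (dilate (ratio c) s) u
    derived′ = child-of-same c c′ (proj₁ same)
    conclude : i ≡ j ⊎ StrictlySeparated (piece i) (piece j) → t ≈ₜ u × child i q ≡ child j q′
    conclude (inj₁ ≡.refl) =
      Derived-unique {+ 10} {piece i} {dilate (ratio c) s} {t} {u} (λ ()) (derived c) derived′ ,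
      ≡.cong (child i) (proj₂ same)
    conclude (inj₂ apart)  = contradiction inside-u
      (strictlySeparated⇒disjoint {+ 10} {piece i} {piece j} {dilate (ratio c) s} {t} {u} {z} (independent c)
        (piece-balanced i) (piece-balanced j) (derived c) derived′ apart in-t)

  packing : ∀ {n t u q q′ z} → Labelled n t q → Labelled n u q′ → In t z → Inside u z → t ≈ₜ u × q ≡ q′
  packing (base t≈K) (base u≈K) _ _ = ≈ₜ-trans t≈K (≈ₜ-sym u≈K) , ≡.refl
  packing (step ls c) (step ls′ c′) = packing-step c c′ (packing ls ls′)

  -- Relative positions and states of touching tiles

  Derived-scalar : ∀ {t u} c → t ≈ₜ u → Derived c (scalar c) t u
  Derived-scalar {t} {u} c t≈u a k = trans (*-congˡ (sym (≈ₜ-elim t≈u a k))) (identity k (⟦ t ⟧ a))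
    where
    identity : ∀ k v → ι c * v k ≈ ιᵥ (scalar c k) ∙ v
    identity 0F v = solve 4
      (λ c x y z → c :* x := c :* x :+ con (+ 0) :* y :+ con (+ 0) :* z) refl (ι c) (v 0F) (v 1F) (v 2F)
    identity 1F v = solve 4
      (λ c x y z → c :* y := con (+ 0) :* x :+ c :* y :+ con (+ 0) :* z) refl (ι c) (v 0F) (v 1F) (v 2F)
    identity 2F v = solve 4
      (λ c x y z → c :* z := con (+ 0) :* x :+ con (+ 0) :* y :+ c :* z) refl (ι c) (v 0F) (v 1F) (v 2F)

  Derived-identity : ∀ {t u} → t ≈ₜ u → Derived (+ 10) (neighbour 0F) t u
  Derived-identity {t} {u} t≈u =
    Derived-congₘ {+ 10} {scalar (+ 10)} {neighbour 0F} {t} {u} neighbour-identity (Derived-scalar (+ 10) t≈u)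

  Derived-identity⁻ : ∀ {t u} → Derived (+ 10) (neighbour 0F) t u → t ≈ₜ u
  Derived-identity⁻ {t} {u} d =
    Derived-unique {+ 10} {neighbour 0F} {t} {t} {u} (λ ()) (Derived-identity ≈ₜ-refl) d

  -- The invariant of the descent: an entry of `contactTable` that accounts for the position, the
  -- types and the colour difference of the pair.
  record Contact (t u : Triangle) (q q′ : State) : Set where
    field
      kind      : Fin 12
      shift     : Fin 3
      neighbour-derived : Derived (+ 10) (neighbour kind) t u
      listed    : (proj₁ q , proj₁ q′ , shift) ∈ₗ contacts kind
      shifted   : proj₂ q′ ≡ proj₂ q ⊕ shift

  Touch-parents : ∀ {i j s s′ t u} → IsChild i s t → IsChild j s′ u → Touch t u → Touch s s′
  Touch-parents {s = s} {s′} {t} {u} c c′ (p , q , p≉q , p∈ , q∈) =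
    proj₁ (common p∈) , proj₁ (common q∈) ,
    (λ y≈w → p≉q (≈ₚ-trans (proj₁ (proj₂ (common p∈)))
      (≈ₚ-trans (scaled y≈w) (≈ₚ-sym (proj₁ (proj₂ (common q∈))))))) ,
    proj₂ (proj₂ (common p∈)) , proj₂ (proj₂ (common q∈))
    where
    scaled : ∀ {y w} → y ≈ₚ w → ratio c *ₚ y ≈ₚ ratio c *ₚ w
    scaled (x , y) = *-congˡ x , *-congˡ y

    common : ∀ {z} → In t z × In u z → ∃[ y ] z ≈ₚ ratio c *ₚ y × In s y × In s′ y
    common (z∈t , z∈u) = join (In-parent c z∈t) (In-parent c′ z∈u)
      where
      join : ∀ {z} → ∃[ y ] z ≈ₚ ratio c *ₚ y × In s y → ∃[ y ] z ≈ₚ ratio c′ *ₚ y × In s′ y →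
             ∃[ y ] z ≈ₚ ratio c *ₚ y × In s y × In s′ y
      join (y , z≈ry , y∈s) (y′ , z≈r′y′ , y′∈s′) =
        y , z≈ry , y∈s , In-cong ≈ₜ-refl (≈ₚ-sym (common-point c c′ z≈ry z≈r′y′)) y′∈s′

  -- Both pieces are expressed in the inflated parent s at scale 100. Separation would contradict
  -- touching; otherwise the coordinates of u factor through `piece i`, and cancelling it leaves the
  -- new position.
  contact-step : ∀ {i j s s′ t u q q′} → IsChild i s t → IsChild j s′ u →
    Contact s s′ q q′ → Touch t u → Contact t u (child i q) (child j q′)
  contact-step {i} {j} {s} {s′} {t} {u} {x , a} {x′ , a′} c c′ above touch = conclude (pieces-meet kind i j)
    where
    open Contact above
    r = ratio c

    to-t : Derived (+ 100) (scalar (+ 10) ⊗ piece i) (dilate r s) t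
    to-t = Derived-trans {+ 10} {piece i} {dilate r s} {t} {+ 10} {scalar (+ 10)} {t}
      (derived c) (Derived-scalar (+ 10) ≈ₜ-refl)

    to-u : Derived (+ 100) (piece j ⊗ neighbour kind) (dilate r s) u
    to-u = Derived-trans {+ 10} {neighbour kind} {dilate r s} {dilate r s′} {+ 10} {piece j} {u}
      (Derived-dilate {+ 10} {neighbour kind} {s} {s′} r neighbour-derived)
      (Derived-cong {+ 10} {piece j} (≈ₜ-sym (dilate-cong (ratio-unique c c′) ≈ₜ-refl)) ≈ₜ-refl (derived c′))

    conclude : Separated (scalar (+ 10) ⊗ piece i) (piece j ⊗ neighbour kind) ⊎ ∃[ f ] Neighbourly kind i j f →
               Contact t u (child i (x , a)) (child j (x′ , a′))
    conclude (inj₁ separated) = contradiction touch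
      (separated⇒¬touch {+ 100} {scalar (+ 10) ⊗ piece i} {piece j ⊗ neighbour kind} {dilate r s} {t} {u}
        (independent c)
        (⊗-balanced {+ 10} {+ 10} {piece i} {scalar (+ 10)} (piece-balanced i)
          (from-yes (balanced? (+ 10) (scalar (+ 10)))))
        (⊗-balanced {+ 10} {+ 10} {neighbour kind} {piece j} (neighbour-balanced kind) (piece-balanced j))
        to-t to-u separated)
    conclude (inj₂ (f , neighbourly)) = record
      { kind = f
      ; shift = proj₁ descended
      ; neighbour-derived = Derived-cancel {+ 10} {piece i} {dilate r s} {t} {+ 10} {neighbour f} {u} (λ ()) (derived c)
          (Derived-congₘ {+ 100} {piece j ⊗ neighbour kind} {neighbour f ⊗ piece i} {dilate r s} {u} neighbourly to-u)
      ; listed = proj₁ (proj₂ descended)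
      -- Associativity isolates a on the left, and the equation of `contacts-descend` exchanges the
      -- two remaining sums.
      ; shifted = ≡.trans (≡.cong (_⊕ childShift j x′) shifted) (≡.trans (⊕-assoc a shift (childShift j x′))
          (≡.trans (≡.cong (a ⊕_) (≡.sym (proj₂ (proj₂ descended))))
            (≡.sym (⊕-assoc a (childShift i x) (proj₁ descended)))))
      }
      where
      descended = All.lookup (contacts-descend kind) listed i j f neighbourly

  -- Touching is passed up to K, and the contact comes back down.
  contact : ∀ {n t u q q′} → Labelled n t q → Labelled n u q′ → Touch t u → Contact t u q q′
  contact (base t≈K) (base u≈K) _ = record
    { kind = 0F ; shift = 0F ; neighbour-derived = Derived-identity (≈ₜ-trans t≈K (≈ₜ-sym u≈K))
    ; listed = identity-contact 0F ; shifted = ⊕-identityʳ 0F }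
  contact (step ls c) (step ls′ c′) touch = contact-step c c′ (contact ls ls′ (Touch-parents c c′ touch)) touch

  Derived-unpiece : ∀ {i s t} (c : IsChild i s t) → Derived (+ 2) (unpiece i) t (dilate (ratio c) s)
  Derived-unpiece {i} {s} {t} c = Derived-cancel {+ 10} {piece i} {F} {t} {+ 2} {unpiece i} {F} (λ ()) (derived c)
    (Derived-congₘ {+ 20} {scalar (+ 20)} {unpiece i ⊗ piece i} {F} {F} (unpiece-piece i)
      (Derived-scalar (+ 20) ≈ₜ-refl))
    where F = dilate (ratio c) s

  -- Both tiles have the same level, so climbing one generation on each side ends at K for both.
  -- Each generation contributes the letter of the two piece indices.
  linked : ∀ {n t u q q′} → Labelled n t q → Labelled n u q′ → ∃[ w ] Derived (wordScale w) (wordMatrix w) t u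
  linked (base t≈K) (base u≈K) = [] , Derived-scalar (+ 10) (≈ₜ-trans t≈K (≈ₜ-sym u≈K))
  linked (step {s = s} {i = i} {t = t} ls c) (step {s = s′} {i = j} {t = u} ls′ c′) =
    (i , j) ∷ w ,
    Derived-trans {wordScale w ℤ.* + 2} {wordMatrix w ⊗ unpiece i} {t} {dilate r s′} {+ 10} {piece j} {u}
      (Derived-trans {+ 2} {unpiece i} {t} {dilate r s} {wordScale w} {wordMatrix w} {dilate r s′}
        (Derived-unpiece c)
        (Derived-dilate {wordScale w} {wordMatrix w} {s} {s′} r (proj₂ (linked ls ls′))))
      (Derived-cong {+ 10} {piece j} (≈ₜ-sym (dilate-cong (ratio-unique c c′) ≈ₜ-refl)) ≈ₜ-refl (derived c′))
    where
    r = ratio c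
    w = proj₁ (linked ls ls′)

  ·-injective : ∀ g {t u} → g · t ≈ₜ g · u → t ≈ₜ u
  ·-injective g (r , s , l) = move-injective g r , move-injective g s , move-injective g l

  third : ∃[ y ] ι (+ 3) * y ≈ 1#
  third = inverse (ι (+ 3)) (ι≉0 {+ 3} λ ())

  centre : Triangle → Point
  centre t = combination t (λ _ → proj₁ third)

  centre-convex : ∀ t → Convex t (centre t) (λ _ → proj₁ third)
  centre-convex t = convex-point t (λ _ → 0≤inverse (0≤fromℕ 3) (proj₂ third))
    (trans (solve 1 (λ y → y :+ y :+ y := con (+ 3) :* y) refl (proj₁ third)) (proj₂ third))

  centre-inside : ∀ t → Inside t (centre t)
  centre-inside t = _ , centre-convex t , λ _ eq → 0≉1 (trans (sym (trans (*-congˡ eq) (zeroʳ _))) (proj₂ third))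

  -- The centre of u lies in t and inside u, so `packing` applies.
  same-label : ∀ {n t u q q′} → Labelled n t q → Labelled n u q′ → t ≈ₜ u → q ≡ q′
  same-label {u = u} lt lu t≈u = proj₂ (packing lt lu
    (In-cong {u} (≈ₜ-sym t≈u) (refl , refl) (_ , centre-convex u)) (centre-inside u))

  -- Equal colours mean shift 0, which the table allows only in position 0, that is, for equal
  -- tiles.
  distinct-colours : ∀ {n t u q q′} → Labelled n t q → Labelled n u q′ →
                     ¬ t ≈ₜ u → Touch t u → proj₂ q ≢ proj₂ q′
  distinct-colours lt lu t≉u touch same =
    [ (λ kind≡0 → t≉u (Derived-identity⁻
        (≡.subst (λ e → Derived (+ 10) (neighbour e) _ _) kind≡0 neighbour-derived)))
    , (λ shift≢0 → shift≢0 (⊕-fixed _ shift (≡.trans same shifted)))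
    ]′ (All.lookup (contacts-change-colour kind) listed)
    where open Contact (contact lt lu touch)

  Boundary⇒In : ∀ {t z} → Boundary t z → In t z
  Boundary⇒In {t} {z} (inj₁ (a , b , 0≤a , 0≤b , sum , x , y)) = vector a b 0# , record
    { nonNegative = λ where 0F → 0≤a ; 1F → 0≤b ; 2F → ≤-refl
    ; total-one   = trans (+-identityʳ _) sum
    ; position    = λ where horizontal → trans x (pad _ _ _) ; vertical → trans y (pad _ _ _)
    }
    where
    pad : ∀ u v w → a * u + b * v ≈ a * u + b * v + 0# * w
    pad u v w = sym (trans (+-congˡ (zeroˡ w)) (+-identityʳ _))
  Boundary⇒In {t} {z} (inj₂ (inj₁ (a , b , 0≤a , 0≤b , sum , x , y))) = vector a 0# b , record
    { nonNegative = λ where 0F → 0≤a ; 1F → ≤-refl ; 2F → 0≤b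
    ; total-one   = trans (+-congʳ (+-identityʳ a)) sum
    ; position    = λ where horizontal → trans x (pad _ _ _) ; vertical → trans y (pad _ _ _)
    }
    where
    pad : ∀ u v w → a * u + b * w ≈ a * u + 0# * v + b * w
    pad u v w = +-congʳ (sym (trans (+-congˡ (zeroˡ v)) (+-identityʳ _)))
  Boundary⇒In {t} {z} (inj₂ (inj₂ (a , b , 0≤a , 0≤b , sum , x , y))) = vector 0# a b , record
    { nonNegative = λ where 0F → ≤-refl ; 1F → 0≤a ; 2F → 0≤b
    ; total-one   = trans (+-congʳ (+-identityˡ a)) sum
    ; position    = λ where horizontal → trans x (pad _ _ _) ; vertical → trans y (pad _ _ _)
    }
    where
    pad : ∀ u v w → a * v + b * w ≈ 0# * u + a * v + b * w
    pad u v w = +-congʳ (sym (trans (+-congʳ (zeroˡ u)) (+-identityˡ _)))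

  Segment-start : ∀ p q → p ∈ Segment p q
  Segment-start p q = 1# , 0# , 0≤1 , ≤-refl , +-identityʳ 1# , at-start _ _ , at-start _ _
    where
    at-start : ∀ x y → x ≈ 1# * x + 0# * y
    at-start x y = sym (trans (+-cong (*-identityˡ x) (zeroˡ y)) (+-identityʳ x))

  Segment-end : ∀ p q → q ∈ Segment p q
  Segment-end p q = 0# , 1# , ≤-refl , 0≤1 , +-identityˡ 1# , at-end _ _ , at-end _ _
    where
    at-end : ∀ x y → y ≈ 0# * x + 1# * y
    at-end x y = sym (trans (+-cong (zeroˡ x) (*-identityˡ y)) (+-identityˡ y))

  shareSegment⇒touch : ∀ {t u} → ShareSegment t u → Touch t u
  shareSegment⇒touch {t} {u} (p , q , p≉q , shared) = p , q , p≉q , both (Segment-start p q) , both (Segment-end p q)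
    where
    both : ∀ {z} → z ∈ Segment p q → In t z × In u z
    both z∈pq = Boundary⇒In {t} (proj₁ (shared _ z∈pq)) , Boundary⇒In {u} (proj₂ (shared _ z∈pq))

  Touch-cong : ∀ {t t′ u u′} → t ≈ₜ t′ → u ≈ₜ u′ → Touch t u → Touch t′ u′
  Touch-cong t≈t′ u≈u′ (p , q , p≉q , (p∈t , p∈u) , (q∈t , q∈u)) =
    p , q , p≉q ,
    (In-cong t≈t′ (refl , refl) p∈t , In-cong u≈u′ (refl , refl) p∈u) ,
    (In-cong t≈t′ (refl , refl) q∈t , In-cong u≈u′ (refl , refl) q∈u)

  move-cong : ∀ g {p q} → p ≈ₚ q → move g p ≈ₚ move g q
  move-cong g (x , y) = +-congʳ (+-cong (*-congʳ x) (*-congʳ y)) , +-congʳ (+-cong (*-congʳ x) (*-congʳ y))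

  ·-cong : ∀ g {t u} → t ≈ₜ u → g · t ≈ₜ g · u
  ·-cong g (r , s , l) = move-cong g r , move-cong g s , move-cong g l

  Touch-·⁻ : ∀ g {t u} → Touch (g · t) (g · u) → Touch t u
  Touch-·⁻ g {t} {u} (p , q , p≉q , p∈ , q∈) =
    proj₁ (back p∈) , proj₁ (back q∈) ,
    (λ y≈w → p≉q (≈ₚ-trans (proj₁ (proj₂ (back p∈)))
      (≈ₚ-trans (move-cong g y≈w) (≈ₚ-sym (proj₁ (proj₂ (back q∈))))))) ,
    proj₂ (proj₂ (back p∈)) , proj₂ (proj₂ (back q∈))
    where
    join : ∀ {z} → ∃[ y ] z ≈ₚ move g y × In t y → ∃[ y ] z ≈ₚ move g y × In u y →
           ∃[ y ] z ≈ₚ move g y × In t y × In u y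
    join (y , z≈gy , y∈t) (y′ , z≈gy′ , y′∈u) =
      y , z≈gy , y∈t , In-cong {u} ≈ₜ-refl (≈ₚ-sym (move-injective g (≈ₚ-trans (≈ₚ-sym z≈gy) z≈gy′))) y′∈u
    back : ∀ {z} → In (g · t) z × In (g · u) z → ∃[ y ] z ≈ₚ move g y × In t y × In u y
    back (z∈gt , z∈gu) = join (In-·⁻ {t} g z∈gt) (In-·⁻ {u} g z∈gu)

  -- The colouring

  module Colour (P : Pred Triangle 0ℓ) (pinwheel : IsPinwheelTiling P) where
    open IsPinwheelTiling pinwheel
    open IsTiling isTiling

    origin-tile : Σ Triangle P
    origin-tile = proj₁ found , proj₁ (proj₂ found)
      where found = covers (point 0 0)

    t₀ : Triangle
    t₀ = proj₁ origin-tile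

    Reached : Word → Triangle → Set
    Reached w t = P t × Derived (wordScale w) (wordMatrix w) t₀ t

    -- The decision is an argument so that `tileOf-unique` can split on it. Words that reach no tile
    -- of P repeat the base tile.
    tileOf : (w : Word) → Dec (∃ (Reached w)) → Σ Triangle P
    tileOf w (yes (t , t∈P , _)) = t , t∈P
    tileOf w (no _)              = origin-tile

    tileAt : ℕ → Σ Triangle P
    tileAt n = tileOf (wordAt n) em

    patch-linked : ∀ {t} n g → image g (ωⁿK n) t₀ → image g (ωⁿK n) t →
                   ∃[ w ] Derived (wordScale w) (wordMatrix w) t₀ t
    patch-linked n g (s , s∈ , t₀≈gs) (u , u∈ , t≈gu) = w , Derived-cong {wordScale w} {wordMatrix w}
      (≈ₜ-sym t₀≈gs) (≈ₜ-sym t≈gu) (Derived-· {wordScale w} {wordMatrix w} {s} {u} g (word-balanced w) (proj₂ link))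
      where
      link = linked (proj₂ (labelled n s∈)) (proj₂ (labelled n u∈))
      w = proj₁ link

    tileOf-unique : ∀ w {t} → Reached w t → ∀ d → proj₁ (tileOf w d) ≈ₜ t
    tileOf-unique w {t} (_ , d) (yes (u , _ , d′)) =
        Derived-unique {wordScale w} {wordMatrix w} {t₀} {u} {t} (wordScale≢0 w) d′ d
    tileOf-unique w reached (no none) = contradiction (_ , reached) none

    patch-word : ∀ {t} → t ∈ P → ∃[ w ] Derived (wordScale w) (wordMatrix w) t₀ t
    patch-word {t} t∈P = go (patches (t₀ ∷ t ∷ []) (proj₂ origin-tile All.∷ t∈P All.∷ All.[]))
      where
      go : ∃[ n ] ∃[ g ] All (image g (ωⁿK n)) (t₀ ∷ t ∷ []) → ∃[ w ] Derived (wordScale w) (wordMatrix w) t₀ t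
      go (n , g , t₀∈ All.∷ t∈ All.∷ All.[]) = patch-linked n g t₀∈ t∈

    tileAt-surjective : ∀ {t} → t ∈ P → ∃[ n ] proj₁ (tileAt n) ≈ₜ t
    tileAt-surjective {t} t∈P = proj₁ index , ≡.subst (λ w → proj₁ (tileOf w em) ≈ₜ t) (≡.sym (proj₂ index))
      (tileOf-unique (proj₁ (patch-word t∈P)) (t∈P , proj₂ (patch-word t∈P)) em)
      where index = wordAt-surjective (proj₁ (patch-word t∈P))

    tile : ℕ → Triangle
    tile n = proj₁ (tileAt n)

    -- The enumeration repeats tiles, so equal colours on repetitions are part of the constraint;
    -- this later yields `colour-cong`.
    Compatible : ℕ → ℕ → Fin 3 → Fin 3 → Set
    Compatible i j a b = (tile i ≈ₜ tile j → a ≡ b) × (¬ tile i ≈ₜ tile j → Touch (tile i) (tile j) → a ≢ b)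

    open Compactness em Compatible

    -- The first n tiles lie in a single copy of some ωᵐ(K), and the labels there colour them.
    finite : ∀ n → ∃[ c ] ProperBelow n c
    finite n = go (patches (applyUpTo tile n) (All.applyUpTo⁺₂ tile n (λ i → proj₂ (tileAt i))))
      where
      go : ∃[ m ] ∃[ g ] All (image g (ωⁿK m)) (applyUpTo tile n) → ∃[ c ] ProperBelow n c
      go (m , g , all) = c , λ i j i<n j<n →
          ≡.subst₂ (Compatible i j) (≡.sym (c-below i<n)) (≡.sym (c-below j<n)) (compatible i<n j<n)
        where
        preimage : ∀ {i} → i ℕ.< n → image g (ωⁿK m) (tile i)
        preimage = All.applyUpTo⁻ tile n all
        state : ∀ {i} (i<n : i ℕ.< n) → ∃[ q ] Labelled m (proj₁ (preimage i<n)) q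
        state i<n = labelled m (proj₁ (proj₂ (preimage i<n)))
        tile≈ : ∀ {i} (i<n : i ℕ.< n) → tile i ≈ₜ g · proj₁ (preimage i<n)
        tile≈ i<n = proj₂ (proj₂ (preimage i<n))
        colour-of : ∀ {i} → Dec (i ℕ.< n) → Fin 3
        colour-of (yes i<n) = proj₂ (proj₁ (state i<n))
        -- Arbitrary, as `ProperBelow n` looks only at indices below n.
        colour-of (no _)    = 0F
        c : ℕ → Fin 3
        c i = colour-of (i ℕ.<? n)
        c-below : ∀ {i} (i<n : i ℕ.< n) → c i ≡ proj₂ (proj₁ (state i<n))
        c-below {i} i<n = helper (i ℕ.<? n)
          where
          helper : (d : Dec (i ℕ.< n)) → colour-of d ≡ proj₂ (proj₁ (state i<n))
          -- The preimage of tile i is chosen from a proof of i < n, so the two proofs must be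
          -- identified.
          helper (yes i<n′) = ≡.cong (λ p → proj₂ (proj₁ (state p))) (ℕ.<-irrelevant i<n′ i<n)
          helper (no i≮n)   = contradiction i<n i≮n
        compatible : ∀ {i j} (i<n : i ℕ.< n) (j<n : j ℕ.< n) →
          Compatible i j (proj₂ (proj₁ (state i<n))) (proj₂ (proj₁ (state j<n)))
        compatible i<n j<n =
            (λ i≈j → ≡.cong proj₂ (same-label (proj₂ (state i<n)) (proj₂ (state j<n))
              (·-injective g (≈ₜ-trans (≈ₜ-sym (tile≈ i<n)) (≈ₜ-trans i≈j (tile≈ j<n))))))
          , (λ i≉j touch → distinct-colours (proj₂ (state i<n)) (proj₂ (state j<n))
              (λ eq → i≉j (≈ₜ-trans (tile≈ i<n) (≈ₜ-trans (·-cong g eq) (≈ₜ-sym (tile≈ j<n)))))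
              (Touch-·⁻ g (Touch-cong (tile≈ i<n) (tile≈ j<n) touch)))

    three-colouring : ProperFaceColouring P 3
    three-colouring = record
      { colour      = λ (t , t∈P) → c (index t∈P)
      ; colour-cong = λ (t , t∈P) (u , u∈P) t≈u → proj₁ (proper (index t∈P) (index u∈P))
          (≈ₜ-trans (at t∈P) (≈ₜ-trans t≈u (≈ₜ-sym (at u∈P))))
      ; proper      = λ (t , t∈P) (u , u∈P) t≉u shared → proj₂ (proper (index t∈P) (index u∈P))
          (λ eq → t≉u (≈ₜ-trans (≈ₜ-sym (at t∈P)) (≈ₜ-trans eq (at u∈P))))
          (Touch-cong (≈ₜ-sym (at t∈P)) (≈ₜ-sym (at u∈P)) (shareSegment⇒touch shared))
      }
      where
      c = proj₁ (compactness finite)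
      proper = proj₂ (compactness finite)
      index : ∀ {t} → t ∈ P → ℕ
      index t∈P = proj₁ (tileAt-surjective t∈P)
      at : ∀ {t} (t∈P : t ∈ P) → tile (index t∈P) ≈ₜ t
      at t∈P = proj₂ (tileAt-surjective t∈P)

  -- Three adjacent tiles

  Independent-K : Independent K
  Independent-K δ sum pos = λ where
      0F → trans (sym (trans (+-cong (trans (+-congˡ y≈0) (+-identityʳ x)) z≈0) (+-identityʳ x))) sum
      1F → y≈0
      2F → z≈0
    where
    x = δ 0F
    y = δ 1F
    z = δ 2F
    y≈0 : y ≈ 0#
    y≈0 = trans
      (solve 3 (λ x y z → y := x :* con (+ 0) :+ y :* con (+ 1) :+ z :* con (+ 0)) refl x y z)
      (pos horizontal)
    z≈0 : z ≈ 0#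
    z≈0 = *-zero-cancelˡ {ι (+ 2)} (ι≉0 {+ 2} λ ())
      (trans (solve 3 (λ x y z → con (+ 2) :* z := x :* con (+ 0) :+ y :* con (+ 0) :+ z :* con (+ 2)) refl x y z)
        (pos vertical))

  basis : Fin 3 → Vector
  basis k l with k Fin.≟ l
  ... | yes _ = 1#
  ... | no _  = 0#

  basis-diagonal : ∀ k → basis k k ≈ 1#
  basis-diagonal k with k Fin.≟ k
  ... | yes _  = refl
  ... | no k≢k = contradiction ≡.refl k≢k

  basis-off : ∀ {k l} → k ≢ l → basis k l ≈ 0#
  basis-off {k} {l} k≢l with k Fin.≟ l
  ... | yes k≡l = contradiction k≡l k≢l
  ... | no _    = refl

  basis-total : ∀ k → ∑ (basis k) ≈ 1#
  basis-total 0F = trans (+-identityʳ _) (+-identityʳ 1#)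
  basis-total 1F = trans (+-identityʳ _) (+-identityˡ 1#)
  basis-total 2F = trans (+-congʳ (+-identityˡ 0#)) (+-identityˡ 1#)

  basis-∙ : ∀ k v → basis k ∙ v ≈ v k
  basis-∙ k = concentrated {basis k} {k} (λ l l≢k → basis-off (λ k≡l → l≢k (≡.sym k≡l))) (basis-total k)

  vertices-distinct : ∀ {t k l} → Independent t → k ≢ l → ¬ vertex t k ≈ₚ vertex t l
  vertices-distinct {t} {k} {l} ind k≢l eq = 0≉1 (begin
    0#         ≈⟨ basis-off (λ l≡k → k≢l (≡.sym l≡k)) ⟨
    basis l k  ≈⟨ Independent-unique {t} {basis k} {basis l} ind (trans (basis-total k) (sym (basis-total l)))
                    (λ a → trans (basis-∙ k (⟦ t ⟧ a)) (trans (≈ₚ-elim eq a) (sym (basis-∙ l (⟦ t ⟧ a))))) k ⟨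
    basis k k  ≈⟨ basis-diagonal k ⟩
    1#         ∎)

  derive : (c : ℤ) → c ≢ + 0 → Matrix → Triangle → Triangle
  derive c c≢0 M t = triangle (vertex′ 0F) (vertex′ 1F) (vertex′ 2F)
    where
    vertex′ : Fin 3 → Point
    vertex′ k = ⟨ proj₁ (inverse (ι c) (ι≉0 c≢0)) * (ιᵥ (M k) ∙ ⟦ t ⟧ horizontal)
                , proj₁ (inverse (ι c) (ι≉0 c≢0)) * (ιᵥ (M k) ∙ ⟦ t ⟧ vertical) ⟩

  Derived-derive : ∀ c (c≢0 : c ≢ + 0) M t → Derived c M t (derive c c≢0 M t)
  Derived-derive c c≢0 M t = λ where
      horizontal 0F → undo _
      horizontal 1F → undo _
      horizontal 2F → undo _
      vertical   0F → undo _
      vertical   1F → undo _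
      vertical   2F → undo _
    where
    undo : ∀ x → ι c * (proj₁ (inverse (ι c) (ι≉0 c≢0)) * x) ≈ x
    undo x = trans (sym (*-assoc _ _ x)) (trans (*-congʳ (proj₂ (inverse (ι c) (ι≉0 c≢0)))) (*-identityˡ x))

  -- The point with barycentric coordinates (3 , -1 , -1).
  outside : Triangle → Point
  outside t = ⟨ outside-weights ∙ ⟦ t ⟧ horizontal , outside-weights ∙ ⟦ t ⟧ vertical ⟩
    where
    outside-weights : Vector
    outside-weights = vector (ι (+ 3)) (ι -[1+ 0 ]) (ι -[1+ 0 ])

  outside∉ : ∀ {t} → Independent t → ¬ In t (outside t)
  outside∉ {t} ind (α , cx) = fromℕ-suc≉0 0 (+-nonNegative-zeroʳ (nonNegative cx 1F) (0≤fromℕ 1) (begin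
    α 1F + ι (+ 1)         ≈⟨ +-congʳ (weights 1F) ⟩
    ι -[1+ 0 ] + ι (+ 1)   ≈⟨ ι-+ -[1+ 0 ] (+ 1) ⟨
    0#                     ∎))
    where
    w = vector (ι (+ 3)) (ι -[1+ 0 ]) (ι -[1+ 0 ])
    weights : α ≋ w
    weights = Independent-unique {t} {α} {w} ind
      (trans (total-one cx) (trans (sym ι-1) (solve 0 (con (+ 1) := con (+ 3) :+ con -[1+ 0 ] :+ con -[1+ 0 ]) refl)))
      λ where
        horizontal → sym (position cx horizontal)
        vertical   → sym (position cx vertical)

  -- The inflated parent that t would have if it were the i-th piece. Keeping it inflated leaves all
  -- coordinates rational, without √5.
  parentFrame : Fin 5 → Triangle → Triangle
  parentFrame i = derive (+ 2) (λ ()) (unpiece i)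

  companion : Fin 5 → Triangle → Triangle
  companion j = derive (+ 10) (λ ()) (piece j)

  companion-child : ∀ {i s t} j (c : IsChild i s t) → IsChild j s (companion j (dilate (ratio c) s))
  companion-child {s = s} j c = record
    { ratio       = ratio c
    ; 0≤ratio     = 0≤ratio c
    ; ratio²≈5    = ratio²≈5 c
    ; independent = independent c
    ; derived     = Derived-derive (+ 10) (λ ()) (piece j) (dilate (ratio c) s)
    }

  parentFrame-· : ∀ g {i s t t′} (c : IsChild i s t′) → t ≈ₜ g · t′ → g · dilate (ratio c) s ≈ₜ parentFrame i t
  parentFrame-· g {i} {s} {t} {t′} c t≈gt′ =
    Derived-unique {+ 2} {unpiece i} {t} {g · dilate (ratio c) s} {parentFrame i t} (λ ())
      (Derived-cong {+ 2} {unpiece i} (≈ₜ-sym t≈gt′) ≈ₜ-refl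
        (Derived-· {+ 2} {unpiece i} {t′} {dilate (ratio c) s} g (unpiece-balanced i) (Derived-unpiece c)))
      (Derived-derive (+ 2) (λ ()) (unpiece i) t)

  companion-· : ∀ g j {F F′} → g · F ≈ₜ F′ → g · companion j F ≈ₜ companion j F′
  companion-· g j {F} {F′} gF≈F′ =
    Derived-unique {+ 10} {piece j} {F′} {g · companion j F} {companion j F′} (λ ())
    (Derived-cong {+ 10} {piece j} gF≈F′ ≈ₜ-refl
      (Derived-· {+ 10} {piece j} {F} {companion j F} g (piece-balanced j) (Derived-derive (+ 10) (λ ()) (piece j) F)))
    (Derived-derive (+ 10) (λ ()) (piece j) F′)

  Convex-unique : ∀ {t u z y α} → t ≈ₜ u → Convex t z α → Convex u y α → z ≈ₚ y
  Convex-unique {α = α} t≈u cx cy = ≈ₚ-intro λ a →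
    trans (position cx a) (trans (∙-congʳ α (≈ₜ-elim t≈u a)) (sym (position cy a)))

  centre-· : ∀ g {t u} → g · t ≈ₜ u → move g (centre t) ≈ₚ centre u
  centre-· g {t} {u} gt≈u = Convex-unique gt≈u (Convex-· {t} g (centre-convex t)) (centre-convex u)

  -- Pulled back by g, the centre of b is the centre of a, which is interior to a. Hence `packing`
  -- identifies the preimage of u with a.
  covering-tile : ∀ {n g a b u q} → Labelled n a q → g · a ≈ₜ b → image g (ωⁿK n) u → In u (centre b) → u ≈ₜ b
  covering-tile {n} {g} {a} {b} {u} la ga≈b (u′ , u′∈ , u≈gu′) in-u =
    ≈ₜ-trans u≈gu′ (≈ₜ-trans (·-cong g (proj₁ (packing (proj₂ (labelled n u′∈)) la centre∈u′ (centre-inside a)))) ga≈b)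
    where
    found : ∃[ y ] centre b ≈ₚ move g y × In u′ y
    found = In-·⁻ {u′} g (In-cong {u} u≈gu′ (refl , refl) in-u)
    centre∈u′ : In u′ (centre a)
    centre∈u′ = In-cong {u′} ≈ₜ-refl
      (move-injective g (≈ₚ-trans (≈ₚ-sym (proj₁ (proj₂ found))) (≈ₚ-sym (centre-· g ga≈b)))) (proj₂ (proj₂ found))

  module Triple (F : Triangle) where
    A B C : Triangle
    A = companion 0F F
    B = companion 1F F
    C = companion 2F F

    same-vertex : ∀ i j k l → (∀ m → piece i k m ≡ piece j l m) → vertex (companion i F) k ≈ₚ vertex (companion j F) l
    same-vertex i j k l rows = ≈ₚ-intro λ a → *-cancelˡ (ι≉0 {+ 10} λ ()) (begin
      ι (+ 10) * ⟦ companion i F ⟧ a k  ≈⟨ Derived-derive (+ 10) (λ ()) (piece i) F a k ⟩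
      ιᵥ (piece i k) ∙ ⟦ F ⟧ a          ≈⟨ ∙-congˡ (⟦ F ⟧ a) (λ m → ι-cong (rows m)) ⟩
      ιᵥ (piece j l) ∙ ⟦ F ⟧ a          ≈⟨ Derived-derive (+ 10) (λ ()) (piece j) F a l ⟨
      ι (+ 10) * ⟦ companion j F ⟧ a l  ∎)

    midpoint : ∀ a → ι (+ 2) * ⟦ B ⟧ a 0F ≈ ⟦ A ⟧ a 0F + ⟦ A ⟧ a 2F
    midpoint a = *-cancelˡ (ι≉0 {+ 10} λ ()) (begin
      ι (+ 10) * (ι (+ 2) * ⟦ B ⟧ a 0F)
        ≈⟨ swap (ι (+ 10)) (ι (+ 2)) _ ⟩
      ι (+ 2) * (ι (+ 10) * ⟦ B ⟧ a 0F)
        ≈⟨ *-congˡ (Derived-derive (+ 10) (λ ()) (piece 1F) F a 0F) ⟩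
      ι (+ 2) * (ιᵥ (piece 1F 0F) ∙ ⟦ F ⟧ a)
        ≈⟨ ∙-scaleˡ (ι (+ 2)) (ιᵥ (piece 1F 0F)) (⟦ F ⟧ a) ⟨
      (λ l → ι (+ 2) * ι (piece 1F 0F l)) ∙ ⟦ F ⟧ a
        ≈⟨ ∙-congˡ (⟦ F ⟧ a) (λ l → trans (sym (ι-* (+ 2) (piece 1F 0F l)))
             (trans (ι-cong (right₁-midpoint l)) (ι-+ (piece 0F 0F l) (piece 0F 2F l)))) ⟩
      (λ l → ι (piece 0F 0F l) + ι (piece 0F 2F l)) ∙ ⟦ F ⟧ a
        ≈⟨ ∑-cong (λ l → distribʳ (⟦ F ⟧ a l) (ι (piece 0F 0F l)) (ι (piece 0F 2F l))) ⟩
      ∑ (λ l → ι (piece 0F 0F l) * ⟦ F ⟧ a l + ι (piece 0F 2F l) * ⟦ F ⟧ a l)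
        ≈⟨ solve 6 (λ a b c d e f → (a :+ d) :+ (b :+ e) :+ (c :+ f) := (a :+ b :+ c) :+ (d :+ e :+ f)) refl _ _ _ _ _ _ ⟩
      ιᵥ (piece 0F 0F) ∙ ⟦ F ⟧ a + ιᵥ (piece 0F 2F) ∙ ⟦ F ⟧ a
        ≈⟨ +-cong (Derived-derive (+ 10) (λ ()) (piece 0F) F a 0F) (Derived-derive (+ 10) (λ ()) (piece 0F) F a 2F) ⟨
      ι (+ 10) * ⟦ A ⟧ a 0F + ι (+ 10) * ⟦ A ⟧ a 2F
        ≈⟨ distribˡ (ι (+ 10)) (⟦ A ⟧ a 0F) (⟦ A ⟧ a 2F) ⟨
      ι (+ 10) * (⟦ A ⟧ a 0F + ⟦ A ⟧ a 2F) ∎)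
      where
      swap : ∀ x y z → x * (y * z) ≈ y * (x * z)
      swap = solve 3 (λ x y z → x :* (y :* z) := y :* (x :* z)) refl

  Segment-cong : ∀ {p p′ q q′ z} → p ≈ₚ p′ → q ≈ₚ q′ → z ∈ Segment p q → z ∈ Segment p′ q′
  Segment-cong (px , py) (qx , qy) (a , b , 0≤a , 0≤b , sum , x , y) = a , b , 0≤a , 0≤b , sum ,
    trans x (+-cong (*-congˡ px) (*-congˡ qx)) , trans y (+-cong (*-congˡ py) (*-congˡ qy))

  Segment-sym : ∀ {p q z} → z ∈ Segment p q → z ∈ Segment q p
  Segment-sym (a , b , 0≤a , 0≤b , sum , x , y) = b , a , 0≤b , 0≤a , trans (+-comm b a) sum ,
    trans x (+-comm _ _) , trans y (+-comm _ _)

  IsMidpoint : Point → Point → Point → Set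
  IsMidpoint p q m = ∀ a → ι (+ 2) * coordinate a m ≈ coordinate a p + coordinate a q

  Segment-half : ∀ {p q m z} → IsMidpoint p q m → z ∈ Segment m q → z ∈ Segment p q
  Segment-half {p} {q} {m} {z} mid (a , b , 0≤a , 0≤b , sum , x , y) =
    -- With h = 1/2, the weight a at the midpoint is split evenly between the endpoints.
    a * h , a * h + b , 0≤ah , +-nonNegative 0≤ah 0≤b ,
    (begin
      a * h + (a * h + b)    ≈⟨ solve 3 (λ a b h → a :* h :+ (a :* h :+ b) := a :* (con (+ 2) :* h) :+ b) refl a b h ⟩
      a * (ι (+ 2) * h) + b  ≈⟨ +-congʳ (trans (*-congˡ 2h≈1) (*-identityʳ a)) ⟩
      a + b                  ≈⟨ sum ⟩
      1#                     ∎) ,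
    trans x (along horizontal) , trans y (along vertical)
    where
    h = proj₁ (inverse (ι (+ 2)) (ι≉0 {+ 2} λ ()))
    2h≈1 : ι (+ 2) * h ≈ 1#
    2h≈1 = proj₂ (inverse (ι (+ 2)) (ι≉0 {+ 2} λ ()))
    0≤ah : 0# ≤ a * h
    0≤ah = *-nonNegative 0≤a (0≤inverse (0≤fromℕ 2) 2h≈1)
    along : ∀ i → a * coordinate i m + b * coordinate i q ≈ a * h * coordinate i p + (a * h + b) * coordinate i q
    along i = begin
      a * coordinate i m + b * coordinate i q
        ≈⟨ +-congʳ (*-congˡ (trans (sym (*-identityˡ _)) (*-congʳ (sym 2h≈1)))) ⟩
      a * (ι (+ 2) * h * coordinate i m) + b * coordinate i q
        ≈⟨ solve 5 (λ a b h m q → a :* (con (+ 2) :* h :* m) :+ b :* q := a :* h :* (con (+ 2) :* m) :+ b :* q) refl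
             a b h (coordinate i m) (coordinate i q) ⟩
      a * h * (ι (+ 2) * coordinate i m) + b * coordinate i q
        ≈⟨ +-congʳ (*-congˡ (mid i)) ⟩
      a * h * (coordinate i p + coordinate i q) + b * coordinate i q
        ≈⟨ solve 5 (λ a b h p q → a :* h :* (p :+ q) :+ b :* q := a :* h :* p :+ (a :* h :+ b) :* q) refl
             a b h (coordinate i p) (coordinate i q) ⟩
      a * h * coordinate i p + (a * h + b) * coordinate i q ∎

  midpoint-degenerate : ∀ {p q} → IsMidpoint p q p → p ≈ₚ q
  midpoint-degenerate {p} {q} mid = ≈ₚ-intro λ a → x-y≈0⇒x≈y (trans
    (solve 2 (λ p q → p :- q := con (+ 2) :* p :- (p :+ q)) refl (coordinate a p) (coordinate a q))
    (x≈y⇒x-y≈0 (mid a)))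

  IsMidpoint-cong : ∀ {p q m m′} → m ≈ₚ m′ → IsMidpoint p q m → IsMidpoint p q m′
  IsMidpoint-cong m≈m′ mid a = trans (*-congˡ (sym (≈ₚ-elim m≈m′ a))) (mid a)

  IsMidpoint-sym : ∀ {p q m} → IsMidpoint p q m → IsMidpoint q p m
  IsMidpoint-sym mid a = trans (mid a) (+-comm _ _)

  module MutuallyAdjacent (F : Triangle)
    (independent : ∀ j → Independent (companion j F)) where
    open Triple F

    right-C≈right-B : right C ≈ₚ right B
    right-C≈right-B = same-vertex 2F 1F 0F 0F right₂≡right₁
    short-B≈long-A : short B ≈ₚ long A
    short-B≈long-A = same-vertex 1F 0F 1F 2F short₁≡long₀
    short-C≈right-A : short C ≈ₚ right A
    short-C≈right-A = same-vertex 2F 0F 1F 0F short₂≡right₀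
    long-C≈long-B : long C ≈ₚ long B
    long-C≈long-B = same-vertex 2F 1F 2F 2F long₂≡long₁

    right-A≉long-A : ¬ right A ≈ₚ long A
    right-A≉long-A = vertices-distinct {A} {0F} {2F} (independent 0F) λ ()

    -- Equal right-angle vertices would put the midpoint of the long leg of A at an end of that leg.
    A≉B : ¬ A ≈ₜ B
    A≉B (right≈ , _) = right-A≉long-A (midpoint-degenerate (IsMidpoint-cong (≈ₚ-sym right≈) midpoint))
    A≉C : ¬ A ≈ₜ C
    A≉C (right≈ , _) = right-A≉long-A
      (midpoint-degenerate (IsMidpoint-cong (≈ₚ-sym (≈ₚ-trans right≈ right-C≈right-B)) midpoint))
    B≉C : ¬ B ≈ₜ C
    B≉C (_ , short≈ , _) = right-A≉long-A
      (≈ₚ-sym (≈ₚ-trans (≈ₚ-sym short-B≈long-A) (≈ₚ-trans short≈ short-C≈right-A)))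

    -- The common segment is the short leg of B, the half of the long leg of A that ends at
    -- `long A`. The other half is the short leg of C.
    A∥B : ShareSegment A B
    A∥B = right B , short B , vertices-distinct {B} {0F} {1F} (independent 1F) (λ ()) , λ z z∈ →
      inj₂ (inj₁ (Segment-half midpoint (Segment-cong (refl , refl) short-B≈long-A z∈))) , inj₁ z∈

    A∥C : ShareSegment A C
    A∥C = right C , short C , vertices-distinct {C} {0F} {1F} (independent 2F) (λ ()) , λ z z∈ →
      inj₂ (inj₁ (Segment-sym (Segment-half (IsMidpoint-sym midpoint)
        (Segment-cong right-C≈right-B short-C≈right-A z∈)))) , inj₁ z∈

    B∥C : ShareSegment B C
    B∥C = right B , long B , vertices-distinct {B} {0F} {2F} (independent 1F) (λ ()) , λ z z∈ →
      inj₂ (inj₁ z∈) , inj₂ (inj₁ (Segment-cong (≈ₚ-sym right-C≈right-B) (≈ₚ-sym long-C≈long-B) z∈))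

  three-distinct⇒3≤ : ∀ {k} (a b c : Fin k) → a ≢ b → a ≢ c → b ≢ c → 3 ℕ.≤ k
  three-distinct⇒3≤ {k} a b c a≢b a≢c b≢c = Fin.injective⇒≤ {f = f} injective
    where
    f : Fin 3 → Fin k
    f 0F = a
    f 1F = b
    f 2F = c
    injective : ∀ {i j} → f i ≡ f j → i ≡ j
    injective {0F} {0F} _  = ≡.refl
    injective {0F} {1F} eq = contradiction eq a≢b
    injective {0F} {2F} eq = contradiction eq a≢c
    injective {1F} {0F} eq = contradiction (≡.sym eq) a≢b
    injective {1F} {1F} _  = ≡.refl
    injective {1F} {2F} eq = contradiction eq b≢c
    injective {2F} {0F} eq = contradiction (≡.sym eq) a≢c
    injective {2F} {1F} eq = contradiction (≡.sym eq) b≢c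
    injective {2F} {2F} _  = ≡.refl

  -- Siblings of a tile and the lower bound

  module Bound (P : Pred Triangle 0ℓ) (pinwheel : IsPinwheelTiling P) where
    open IsPinwheelTiling pinwheel
    open IsTiling isTiling

    tileOver : Point → Triangle
    tileOver z = proj₁ (covers z)

    tileOver∈P : ∀ z → tileOver z ∈ P
    tileOver∈P z = proj₁ (proj₂ (covers z))

    tileOver-covers : ∀ z → In (tileOver z) z
    tileOver-covers z = Closed⇒In (proj₂ (proj₂ (covers z)))

    P-independent : ∀ {t} → t ∈ P → Independent t
    P-independent t∈P = Independent-cong (≈ₜ-sym (proj₂ (copies t∈P)))
      (Independent-· {K} (proj₁ (copies t∈P)) Independent-K)

    t : Triangle
    t = tileOver (point 0 0)

    candidate : Fin 5 → Fin 5 → Triangle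
    candidate i j = companion j (parentFrame i t)

    -- t may be any of the five pieces of its parent, so the centres of all the
    -- possible siblings are probed; the outside point excludes a patch with one tile.
    candidateCentres : List Point
    candidateCentres = cartesianProductWith (λ i j → centre (candidate i j)) (allFin 5) (allFin 5)

    probes : List Point
    probes = point 0 0 ∷ outside t ∷ candidateCentres

    outside-tile≉t : ¬ tileOver (outside t) ≈ₜ t
    outside-tile≉t eq = outside∉ {t} (P-independent (tileOver∈P (point 0 0)))
      (In-cong eq (refl , refl) (tileOver-covers (outside t)))

    siblings : ∃[ i ] ∀ j → candidate i j ∈ P
    siblings = go (patches (map tileOver probes) (All.map⁺ (All.universal tileOver∈P probes)))
      where
      go : ∃[ n ] ∃[ g ] All (image g (ωⁿK n)) (map tileOver probes) → ∃[ i ] ∀ j → candidate i j ∈ P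
      go (n , g , in-patch) = descend (proj₂ (labelled n (proj₁ (proj₂ t-in)))) (proj₂ (proj₂ t-in))
        where
        in-image : ∀ {z} → z ∈ₗ probes → image g (ωⁿK n) (tileOver z)
        in-image z∈ = All.lookup in-patch (∈-map⁺ tileOver z∈)

        t-in : image g (ωⁿK n) t
        t-in = in-image (here ≡.refl)

        outside-in : image g (ωⁿK n) (tileOver (outside t))
        outside-in = in-image (there (here ≡.refl))

        descend : ∀ {t′ q} → Labelled n t′ q → t ≈ₜ g · t′ → ∃[ i ] ∀ j → candidate i j ∈ P
        -- A patch of level 0 has only one tile, so t would also be the tile over the outside point.
        descend (base t′≈K) t≈gt′ = contradiction
          (≈ₜ-trans (proj₂ (proj₂ outside-in))
            (≈ₜ-trans (·-cong g (≈ₜ-trans (proj₁ (proj₂ outside-in)) (≈ₜ-sym t′≈K))) (≈ₜ-sym t≈gt′)))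
          outside-tile≉t
        -- Here i is the actual index of t in its parent. The sibling j is labelled directly, as
        -- `Labelled` asks only for an `IsChild`; so the probed tile over its centre equals it, and
        -- `respects` moves membership in P to the candidate.
        descend (step {i = i} ls c) t≈gt′ = i , λ j → respects
          (covering-tile {n} {g} {b = candidate i j} {tileOver (centre (candidate i j))}
            (step ls (companion-child j c)) (companion-· g j (parentFrame-· g c t≈gt′))
            (in-image (there (there (∈-cartesianProductWith⁺ (λ i j → centre (candidate i j))
              (∈-allFin i) (∈-allFin j)))))
            (tileOver-covers (centre (candidate i j))))
          (tileOver∈P (centre (candidate i j)))

    lower-bound : ∀ k → ProperFaceColouring P k → 3 ℕ.≤ k
    lower-bound k colouring = three-distinct⇒3≤ (colour (A , ∈P 0F)) (colour (B , ∈P 1F)) (colour (C , ∈P 2F))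
        (proper _ _ A≉B A∥B) (proper _ _ A≉C A∥C) (proper _ _ B≉C B∥C)
      where
      open ProperFaceColouring colouring
      ∈P : ∀ j → companion j (parentFrame (proj₁ siblings) t) ∈ P
      ∈P = proj₂ siblings
      open Triple (parentFrame (proj₁ siblings) t)
      open MutuallyAdjacent (parentFrame (proj₁ siblings) t) (λ j → P-independent (∈P j))

theorem6p9 : ExcludedMiddle 0ℓ →
    (ℝ : CompleteOrderedField) →
    let open Pinwheel ℝ in
    (P : Pred Triangle 0ℓ) → IsPinwheelTiling P →
    IsMinimum (ProperFaceColouring P) 3
theorem6p9 em ℝ P pinwheel = three-colouring , lower-bound
  where
  open Geometry em ℝ
  open Colour P pinwheel using (three-colouring)
  open Bound P pinwheel using (lower-bound)
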